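{- For all integers $r\ge 3$ and $s\ge 2$ there exists $n(r,s)$ such that for every integer $n>n(r,s)$, $$m_0(s,n;r) = s n^{r-1} - (n-1)^{r-1} + n - s.$$
   Context: For $1\le \ell\le r$ let $X_\ell=\{1,\dots,n_\ell\}$. An $r$-partite $r$-graph is a family $\mathcal{F}\subseteq X_1\times\dots\times X_r$; for $A$ in this product, $A[\ell]$ denotes its $\ell$-th coordinate. Viewing $X_1,\dots,X_r$ as pairwise disjoint sets, each sequence $A$ is identified with the $r$-element set $\{A[1],\dots,A[r]\}\subseteq X_1\sqcup\dots\sqcup X_r$. Two sequences $A,B$ are disjoint if $A[\ell]\ne B[\ell]$ for all $\ell$; a matching is a collection of pairwise disjoint members; $\nu(\mathcal{F})$ is the maximum size of a matching in $\mathcal{F}$. A transversal of $\mathcal{F}$ is a set $T\subseteq X_1\sqcup\dots\sqcup X_r$ meeting every member of $\mathcal{F}$, and $\tau(\mathcal{F})$ is the minimum size of a transversal. For $r\ge 3$ and $n_1\ge\dots\ge n_r>s\ge1$, $m_0(s,n_1,\dots,n_r)$ is the maximum of $|\mathcal{F}|$ over $\mathcal{F}\subseteq X_1\times\dots\times X_r$ with $\nu(\mathcal{F})\le s<\tau(\mathcal{F})$; $m_0(s,n;r)$ denotes $m_0(s,n,\dots,n)$ with $r$ arguments equal to $n$. -}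

module Defs where

open import Data.Nat using (ℕ; _≤_; _<_)
open import Data.Fin using (Fin)
open import Data.Vec using (Vec; lookup)
open import Data.List using (List; length)
open import Data.List.Membership.Propositional using (_∈_)
open import Data.List.Relation.Unary.All using (All)
open import Data.List.Relation.Unary.Unique.Propositional using (Unique)
open import Data.List.Relation.Unary.AllPairs using (AllPairs)
open import Data.Product using (Σ; ∃; _×_; _,_)
open import Relation.Binary.PropositionalEquality using (_≡_; _≢_)

-- A member of X_1 × … × X_r with all X_ℓ = {1..n}, encoded as Fin n (0-based).
Seq : ℕ → ℕ → Set
Seq n r = Vec (Fin n) r

-- An r-partite r-graph: a duplicate-free list of sequences (a finite set); |F| = length F.
Family : ℕ → ℕ → Set
Family n r = List (Seq n r)

Disjoint : ∀ {n r} → Seq n r → Seq n r → Set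
Disjoint {r = r} A B = (ℓ : Fin r) → lookup A ℓ ≢ lookup B ℓ

IsMatching : ∀ {n r} → Family n r → List (Seq n r) → Set
IsMatching F M = All (_∈ F) M × AllPairs Disjoint M

NuAtMost : ∀ {n r} → ℕ → Family n r → Set
NuAtMost s F = ∀ M → IsMatching F M → length M ≤ s

-- A vertex of X_1 ⊔ … ⊔ X_r: a part index ℓ and an element of X_ℓ.
Vertex : ℕ → ℕ → Set
Vertex n r = Σ (Fin r) (λ _ → Fin n)

IsTransversal : ∀ {n r} → Family n r → List (Vertex n r) → Set
IsTransversal {r = r} F T = All (λ A → ∃ λ (ℓ : Fin r) → (ℓ , lookup A ℓ) ∈ T) F

-- s < τ(F): every transversal has more than s elements
-- (a list with repetitions is only longer than its underlying set).
TauAbove : ∀ {n r} → ℕ → Family n r → Set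
TauAbove s F = ∀ T → IsTransversal F T → s < length T

Admissible : (s n r : ℕ) → Family n r → Set
Admissible s n r F = Unique F × NuAtMost s F × TauAbove s F

IsM0 : ℕ → ℕ → ℕ → ℕ → Set
IsM0 s n r m =
  (∃ λ (F : Family n r) → Admissible s n r F × length F ≡ m) ×
  (∀ (F : Family n r) → Admissible s n r F → length F ≤ m)

{-# OPTIONS --safe #-}
-- Call a vertex big if its degree exceeds a suitable constant times n^(r-2).  Big vertices extend any
-- matching that avoids them, so there are at most s of them; since ν ≤ s < τ there cannot be exactly s,
-- and with at most s - 2 the family has at most (s-2)n^(r-1) + O(n^(r-2)) members.  With exactly s - 1
-- big vertices L, the members avoiding L form an intersecting family G without a one-vertex cover.
-- Pairs of vertices lying in more than r n^(r-3) members of G meet every member of G and meet each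
-- other, so they form a star or a triangle, and only O(n^(r-3)) members of G contain no such pair.
-- Hence either G is too small, or it lies in a Hilton-Milner family (star) or in the family of
-- sequences containing at least two of three given vertices (triangle).  Both of these contain, for
-- each v in L, a sequence through v, and these are distinct and outside G: this saves another s - 1.
module Submission where

open import Defs
open import Data.Nat using (ℕ; zero; suc; _+_; _*_; _∸_; _^_; _≤_; _<_; z≤n; s≤s; s≤s⁻¹; NonZero; _≤?_; _<?_; _⊓_; _≟_)
open import Data.Nat.Properties hiding (_≟_; _≤?_; _<?_)
open import Data.Nat.Tactic.RingSolver using (solve-∀)
open import Data.Fin using (Fin; zero; suc; toℕ; fromℕ; inject₁; _↑ˡ_; _↑ʳ_; punchIn)
import Data.Fin.Properties as Fin
open import Data.Vec as Vec using (Vec; []; _∷_; lookup; _[_]≔_)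
import Data.Vec.Properties as Vec
open import Data.List using (List; []; _∷_; length; filter; map; _++_; concatMap; allFin; cartesianProductWith; cartesianProduct; take; upTo)
open import Data.List.Properties using (length-map; length-++; length-tabulate; length-take; length-filter; length-upTo)
open import Data.List.Membership.Propositional using (_∈_; _∉_; find; lose)
open import Data.List.Membership.Propositional.Properties
import Data.List.Membership.DecPropositional as DecMembership
open import Data.List.Relation.Binary.Subset.Propositional using (_⊆_)
open import Data.List.Relation.Unary.All as All using (All; []; _∷_)
import Data.List.Relation.Unary.All.Properties as All
open import Data.List.Relation.Unary.Any as Any using (Any; here; there)
open import Data.List.Relation.Unary.AllPairs as AllPairs using (AllPairs; []; _∷_)
open import Data.List.Relation.Unary.Unique.Propositional using (Unique)
import Data.List.Relation.Unary.Unique.Propositional.Properties as Unique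
open import Data.Product using (∃; _×_; _,_; proj₁; proj₂)
open import Data.Sum using (_⊎_; inj₁; inj₂; [_,_]′)
open import Function using (_∘_; id)
open import Relation.Nullary using (¬_; Dec; yes; no; contradiction)
open import Relation.Unary using (Decidable)
open import Relation.Nullary.Decidable using (¬?; _×-dec_; _⊎-dec_; decidable-stable)
open import Relation.Binary.PropositionalEquality

private
  variable
    X Y : Set
    n r k : ℕ

-- Counting with duplicate-free lists.

length-insert : ∀ (xs : List X) {ys : List X} {x} → length (xs ++ x ∷ ys) ≡ suc (length (xs ++ ys))
length-insert []       = refl
length-insert (_ ∷ xs) = cong suc (length-insert xs)

∈-uninsert : ∀ (xs : List X) {ys : List X} {x z} → z ≢ x → z ∈ xs ++ x ∷ ys → z ∈ xs ++ ys
∈-uninsert xs z≢x z∈ with ∈-++⁻ xs z∈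
... | inj₁ p           = ∈-++⁺ˡ p
... | inj₂ (here eq)   = contradiction eq z≢x
... | inj₂ (there p)   = ∈-++⁺ʳ xs p

-- Cardinalities are compared through inclusions throughout. Only the smaller list is
-- duplicate-free, so `ys` can be a concatenation of overlapping pieces.
unique-⊆⇒length≤ : {xs ys : List X} → Unique xs → xs ⊆ ys → length xs ≤ length ys
unique-⊆⇒length≤ {xs = []} _ _ = z≤n
unique-⊆⇒length≤ {xs = x ∷ xs} (x≢ ∷ xs!) sub with ∈-∃++ (sub (here refl))
... | as , bs , refl = subst (suc (length xs) ≤_) (sym (length-insert as))
  (s≤s (unique-⊆⇒length≤ xs! λ z∈ →
    ∈-uninsert as (λ z≡x → All.lookup x≢ z∈ (sym z≡x)) (sub (there z∈))))

length-concatMap : ∀ (f : X → List Y) c (is : List X) → (∀ i → i ∈ is → length (f i) ≤ c) →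
  length (concatMap f is) ≤ length is * c
length-concatMap f c []       _ = z≤n
length-concatMap f c (i ∷ is) h = subst (_≤ c + length is * c) (sym (length-++ (f i)))
  (+-mono-≤ (h i (here refl)) (length-concatMap f c is λ j j∈ → h j (there j∈)))

covered-length : ∀ {xs : List X} (f : Y → List X) c (is : List Y) → Unique xs →
  (∀ {x} → x ∈ xs → ∃ λ i → i ∈ is × x ∈ f i) →
  (∀ i → i ∈ is → length (f i) ≤ c) → length xs ≤ length is * c
covered-length f c is xs! cov bound = ≤-trans
  (unique-⊆⇒length≤ xs! λ x∈ → let (i , i∈ , x∈fi) = cov x∈ in ∈-concatMap⁺ f (lose i∈ x∈fi))
  (length-concatMap f c is bound)

length-cartesianProductWith : ∀ {Z : Set} (f : X → Y → Z) xs ys →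
  length (cartesianProductWith f xs ys) ≡ length xs * length ys
length-cartesianProductWith f []       ys = refl
length-cartesianProductWith f (x ∷ xs) ys = trans (length-++ (map (f x) ys))
  (cong₂ _+_ (length-map (f x) ys) (length-cartesianProductWith f xs ys))

length-allFin : ∀ n → length (allFin n) ≡ n
length-allFin n = length-tabulate {n = n} id

-- Boxes: products of coordinate lists, and their sizes.

Box : ℕ → ℕ → Set
Box n r = Vec (List (Fin n)) r

sequences : Box n r → Family n r
sequences []       = [] ∷ []
sequences (l ∷ ls) = cartesianProductWith _∷_ l (sequences ls)

_∈ᵇ_ : Seq n r → Box n r → Set
A ∈ᵇ B = ∀ ℓ → lookup A ℓ ∈ lookup B ℓ

∈-sequences⁺ : ∀ (A : Seq n r) (B : Box n r) → A ∈ᵇ B → A ∈ sequences B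
∈-sequences⁺ []      []      _ = here refl
∈-sequences⁺ (a ∷ A) (l ∷ B) h =
  ∈-cartesianProductWith⁺ _∷_ (h zero) (∈-sequences⁺ A B (h ∘ suc))

∈-sequences⁻ : ∀ (A : Seq n r) (B : Box n r) → A ∈ sequences B → A ∈ᵇ B
∈-sequences⁻ (a ∷ A) (l ∷ B) A∈ ℓ with ∈-cartesianProductWith⁻ _∷_ l (sequences B) A∈
∈-sequences⁻ (a ∷ A) (l ∷ B) A∈ zero    | _ , _ , p , q , refl = p
∈-sequences⁻ (a ∷ A) (l ∷ B) A∈ (suc ℓ) | _ , _ , p , q , refl = ∈-sequences⁻ A B q ℓ

sequences-unique : ∀ (B : Box n r) → (∀ ℓ → Unique (lookup B ℓ)) → Unique (sequences B)
sequences-unique []      _ = [] ∷ []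
sequences-unique (l ∷ B) h = Unique.cartesianProductWith⁺ _∷_ Vec.∷-injective
  (h zero) (sequences-unique B (h ∘ suc))

size : Box n r → ℕ
size B = length (sequences B)

size-∷ : ∀ l (B : Box n r) → size (l ∷ B) ≡ length l * size B
size-∷ l B = length-cartesianProductWith _∷_ l (sequences B)

size-const : ∀ c (B : Box n r) → (∀ ℓ → length (lookup B ℓ) ≡ c) → size B ≡ c ^ r
size-const c []      _ = refl
size-const c (l ∷ B) h = trans (size-∷ l B) (cong₂ _*_ (h zero) (size-const c B (h ∘ suc)))

-- The size is proportional to the length of the list at `p`; cross-multiplying avoids a division by
-- the old length.
size-update : ∀ (B : Box n r) p l → size (B [ p ]≔ l) * length (lookup B p) ≡ size B * length l
size-update (k ∷ B) zero l = begin
  size (l ∷ B) * length k         ≡⟨ cong (_* length k) (size-∷ l B) ⟩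
  length l * size B * length k    ≡⟨ swap (length l) (size B) (length k) ⟩
  length k * size B * length l    ≡⟨ cong (_* length l) (size-∷ k B) ⟨
  size (k ∷ B) * length l         ∎
  where
  open ≡-Reasoning
  swap : ∀ a b c → a * b * c ≡ c * b * a
  swap = solve-∀
size-update (k ∷ B) (suc p) l = begin
  size (k ∷ B [ p ]≔ l) * length (lookup B p)
    ≡⟨ cong (_* length (lookup B p)) (size-∷ k (B [ p ]≔ l)) ⟩
  length k * size (B [ p ]≔ l) * length (lookup B p)     ≡⟨ *-assoc (length k) _ _ ⟩
  length k * (size (B [ p ]≔ l) * length (lookup B p))   ≡⟨ cong (length k *_) (size-update B p l) ⟩
  length k * (size B * length l)                         ≡⟨ *-assoc (length k) _ _ ⟨
  length k * size B * length l                           ≡⟨ cong (_* length l) (size-∷ k B) ⟨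
  size (k ∷ B) * length l                                ∎
  where open ≡-Reasoning

full : Box n r
full {n} {r} = Vec.replicate r (allFin n)

lookup-full : ∀ (ℓ : Fin r) → lookup (full {n} {r}) ℓ ≡ allFin n
lookup-full ℓ = Vec.lookup-replicate ℓ _

∈ᵇ-full : (A : Seq n r) → A ∈ᵇ full
∈ᵇ-full A ℓ = subst (lookup A ℓ ∈_) (sym (lookup-full ℓ)) (∈-allFin (lookup A ℓ))

size-full : size (full {n} {r}) ≡ n ^ r
size-full {n} {r} = size-const n (full {n} {r}) λ ℓ →
  trans (cong length (lookup-full {n = n} ℓ)) (length-allFin n)

∈ᵇ-update : ∀ (A : Seq n r) (B : Box n r) p {l} → (∀ ℓ → ℓ ≢ p → lookup A ℓ ∈ lookup B ℓ) →
  lookup A p ∈ l → A ∈ᵇ (B [ p ]≔ l)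
∈ᵇ-update A B p {l} A∈ Ap∈ ℓ with ℓ Fin.≟ p
... | yes refl = subst (lookup A p ∈_) (sym (Vec.lookup∘update p B l)) Ap∈
... | no ℓ≢p   = subst (lookup A ℓ ∈_) (sym (Vec.lookup∘update′ ℓ≢p B l)) (A∈ ℓ ℓ≢p)

∈ᵇ-update⁻ˡ : ∀ (A : Seq n r) (B : Box n r) p l → A ∈ᵇ (B [ p ]≔ l) → lookup A p ∈ l
∈ᵇ-update⁻ˡ A B p l A∈ = subst (lookup A p ∈_) (Vec.lookup∘update p B l) (A∈ p)

∈ᵇ-update⁻ʳ : ∀ (A : Seq n r) (B : Box n r) p l → A ∈ᵇ (B [ p ]≔ l) → ∀ {ℓ} → ℓ ≢ p → lookup A ℓ ∈ lookup B ℓ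
∈ᵇ-update⁻ʳ A B p l A∈ {ℓ} ℓ≢p = subst (lookup A ℓ ∈_) (Vec.lookup∘update′ ℓ≢p B l) (A∈ ℓ)

update-unique : ∀ (B : Box n r) p l → (∀ ℓ → Unique (lookup B ℓ)) → Unique l → ∀ ℓ → Unique (lookup (B [ p ]≔ l) ℓ)
update-unique B p l B! l! ℓ with ℓ Fin.≟ p
... | yes refl = subst Unique (sym (Vec.lookup∘update ℓ B l)) l!
... | no ℓ≢p   = subst Unique (sym (Vec.lookup∘update′ ℓ≢p B l)) (B! ℓ)

-- Incidence of sequences and vertices, and codegrees.

record _∋_ (A : Seq n r) (v : Vertex n r) : Set where
  constructor hit
  field
    at : lookup A (proj₁ v) ≡ proj₂ v

open _∋_

_∋?_ : (A : Seq n r) → Decidable (A ∋_)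
A ∋? (ℓ , a) with lookup A ℓ Fin.≟ a
... | yes eq = yes (hit eq)
... | no neq = no (neq ∘ at)

-- For vertices in distinct parts this is the set of all sequences containing them; if a part is
-- repeated, the entry nearer the head overwrites the other.
through : List (Vertex n r) → Box n r
through []             = full
through ((p , a) ∷ vs) = through vs [ p ]≔ (a ∷ [])

DistinctParts : List (Vertex n r) → Set
DistinctParts = AllPairs (λ u v → proj₁ u ≢ proj₁ v)

lookup-through : ∀ (vs : List (Vertex n r)) p → All (λ v → p ≢ proj₁ v) vs →
  lookup (through vs) p ≡ allFin n
lookup-through []       p _         = lookup-full p
lookup-through (v ∷ vs) p (p≢ ∷ ps) =
  trans (Vec.lookup∘update′ p≢ (through vs) _) (lookup-through vs p ps)

size-through : ∀ (vs : List (Vertex n r)) → DistinctParts vs → size (through vs) * n ^ length vs ≡ n ^ r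
size-through {n} {r} [] _ = trans (*-identityʳ (size (full {n} {r}))) (size-full {n} {r})
size-through {n} {r} ((p , a) ∷ vs) (p≢ ∷ vs!) = begin
  size (through ((p , a) ∷ vs)) * (n * n ^ length vs)
    ≡⟨ *-assoc (size (through ((p , a) ∷ vs))) n _ ⟨
  size (through ((p , a) ∷ vs)) * n * n ^ length vs
    ≡⟨ cong (λ k → size (through ((p , a) ∷ vs)) * k * n ^ length vs)
         (trans (cong length (lookup-through vs p p≢)) (length-allFin n)) ⟨
  size (through vs [ p ]≔ (a ∷ [])) * length (lookup (through vs) p) * n ^ length vs
    ≡⟨ cong (_* n ^ length vs) (size-update (through vs) p (a ∷ [])) ⟩
  size (through vs) * 1 * n ^ length vs
    ≡⟨ cong (_* n ^ length vs) (*-identityʳ (size (through vs))) ⟩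
  size (through vs) * n ^ length vs
    ≡⟨ size-through vs vs! ⟩
  n ^ r ∎
  where open ≡-Reasoning

∈-through : ∀ {A : Seq n r} vs → All (A ∋_) vs → A ∈ᵇ through vs
∈-through {A = A} []             _          = ∈ᵇ-full A
∈-through {A = A} ((p , a) ∷ vs) (eq ∷ eqs) =
  ∈ᵇ-update A (through vs) p (λ ℓ _ → ∈-through vs eqs ℓ) (here (at eq))

∋-distinctParts : ∀ {A : Seq n r} {vs} → All (A ∋_) vs → Unique vs → DistinctParts vs
∋-distinctParts []         []         = []
∋-distinctParts {A = A} {v ∷ vs} (eq ∷ eqs) (v≢ ∷ vs!) = go eqs v≢ ∷ ∋-distinctParts eqs vs!
  where
  go : ∀ {us} → All (A ∋_) us → All (v ≢_) us → All (λ u → proj₁ v ≢ proj₁ u) us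
  go []       []       = []
  go (e ∷ es) (d ∷ ds) =
    (λ { refl → d (cong (_ ,_) (trans (sym (at eq)) (at e))) }) ∷ go es ds

-- A member of a nonempty `F` contains all of `vs`, which puts these vertices in distinct parts;
-- each of them then divides the number of sequences by `n`. Writing the uniformity as `k + r` keeps
-- subtraction out of the exponent.
codegree-bound : ∀ {F : Family n (k + r)} (vs : Vec (Vertex n (k + r)) k) →
  Unique F → Unique (Vec.toList vs) → .{{NonZero n}} →
  (∀ {A} → A ∈ F → All (A ∋_) (Vec.toList vs)) → length F ≤ n ^ r
codegree-bound {F = []} vs _ _ _ = z≤n
codegree-bound {n} {k} {r} {F = F@(_ ∷ _)} vs F! vs! h = *-cancelʳ-≤ (length F) (n ^ r) (n ^ k) {{m^n≢0 n k}} (begin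
  length F * n ^ k
    ≤⟨ *-monoˡ-≤ (n ^ k) (unique-⊆⇒length≤ F! λ {A} A∈ → ∈-sequences⁺ A (through us) (∈-through us (h A∈))) ⟩
  size (through us) * n ^ k
    ≡⟨ cong (λ j → size (through us) * n ^ j) (Vec.length-toList vs) ⟨
  size (through us) * n ^ length us           ≡⟨ size-through us (∋-distinctParts (h (here refl)) vs!) ⟩
  n ^ (k + r)                                 ≡⟨ ^-distribˡ-+-* n k r ⟩
  n ^ k * n ^ r                               ≡⟨ *-comm (n ^ k) (n ^ r) ⟩
  n ^ r * n ^ k                               ∎)
  where
  open ≤-Reasoning
  us = Vec.toList vs

-- Finite search, avoidance and meeting.

search : {P : X → Set} → Decidable P → (xs : List X) →
  (∃ λ x → x ∈ xs × P x) ⊎ (∀ {x} → x ∈ xs → ¬ P x)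
search P? xs with Any.any? P? xs
... | yes p = inj₁ (find p)
... | no ¬p = inj₂ λ x∈ px → ¬p (lose x∈ px)

allVertices : List (Vertex n r)
allVertices {n} {r} = cartesianProduct (allFin r) (allFin n)

∈-allVertices : (v : Vertex n r) → v ∈ allVertices
∈-allVertices (ℓ , a) = ∈-cartesianProduct⁺ (∈-allFin ℓ) (∈-allFin a)

allVertices-unique : Unique (allVertices {n} {r})
allVertices-unique {n} {r} = Unique.cartesianProduct⁺ (Unique.allFin⁺ r) (Unique.allFin⁺ n)

_≟ᵛ_ : (u v : Vertex n r) → Dec (u ≡ v)
(p , a) ≟ᵛ (q , b) with p Fin.≟ q | a Fin.≟ b
... | yes refl | yes refl = yes refl
... | no p≢q   | _        = no (p≢q ∘ cong proj₁)
... | _        | no a≢b   = no (a≢b ∘ cong proj₂)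

vertices : Seq n r → List (Vertex n r)
vertices {r = r} A = map (λ ℓ → ℓ , lookup A ℓ) (allFin r)

length-vertices : (A : Seq n r) → length (vertices A) ≡ r
length-vertices {r = r} A = trans (length-map _ (allFin r)) (length-allFin r)

∋⇒∈-vertices : {A : Seq n r} {v : Vertex n r} → A ∋ v → v ∈ vertices A
∋⇒∈-vertices {v = ℓ , _} (hit refl) = ∈-map⁺ _ (∈-allFin ℓ)

∈-vertices⇒∋ : {A : Seq n r} {v : Vertex n r} → v ∈ vertices A → A ∋ v
∈-vertices⇒∋ v∈ with ∈-map⁻ _ v∈
... | _ , _ , refl = hit refl

∋-unique : ∀ {A : Seq n r} {u v} → A ∋ u → A ∋ v → proj₁ u ≡ proj₁ v → u ≡ v
∋-unique (hit refl) (hit refl) refl = refl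

_avoids_ : Seq n r → List (Vertex n r) → Set
A avoids T = All (λ v → ¬ A ∋ v) T

hits-or-avoids : (A : Seq n r) (T : List (Vertex n r)) → (∃ λ v → v ∈ T × A ∋ v) ⊎ A avoids T
hits-or-avoids A T with search (A ∋?_) T
... | inj₁ h = inj₁ h
... | inj₂ h = inj₂ (All.tabulate h)

_avoids?_ : (A : Seq n r) → Decidable (A avoids_)
A avoids? T = All.all? (λ v → ¬? (A ∋? v)) T

Meet : Seq n r → Seq n r → Set
Meet A B = ∃ λ v → A ∋ v × B ∋ v

meet-or-disjoint : (A B : Seq n r) → Meet A B ⊎ Disjoint A B
meet-or-disjoint A B with Fin.any? (λ ℓ → lookup A ℓ Fin.≟ lookup B ℓ)
... | yes (ℓ , eq) = inj₁ ((ℓ , lookup A ℓ) , hit refl , hit (sym eq))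
... | no ¬eq       = inj₂ λ ℓ eq → ¬eq (ℓ , eq)

avoids-vertices⇒disjoint : (A B : Seq n r) → A avoids vertices B → Disjoint A B
avoids-vertices⇒disjoint A B A# ℓ eq = All.lookup A# (∋⇒∈-vertices {A = B} (hit refl)) (hit eq)

¬meet∧disjoint : {A B : Seq n r} → Meet A B → ¬ Disjoint A B
¬meet∧disjoint ((ℓ , _) , A∋ , B∋) d = d ℓ (trans (at A∋) (sym (at B∋)))

-- Links, members escaping a small vertex set, and maximal matchings.

link : Family n r → List (Vertex n r) → Family n r
link F vs = filter (λ A → All.all? (A ∋?_) vs) F

∈-link⁺ : ∀ {F : Family n r} {vs A} → A ∈ F → All (A ∋_) vs → A ∈ link F vs
∈-link⁺ {vs = vs} = ∈-filter⁺ (λ A → All.all? (A ∋?_) vs)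

∈-link⁻ : ∀ {F : Family n r} vs {A} → A ∈ link F vs → A ∈ F × All (A ∋_) vs
∈-link⁻ {F = F} vs = ∈-filter⁻ (λ A → All.all? (A ∋?_) vs) {xs = F}

link-bound : .{{NonZero n}} → ∀ {F : Family n (k + r)} (vs : Vec (Vertex n (k + r)) k) →
  Unique F → Unique (Vec.toList vs) → length (link F (Vec.toList vs)) ≤ n ^ r
link-bound {F = F} vs F! vs! = codegree-bound vs (Unique.filter⁺ _ F!) vs!
  λ A∈ → proj₂ (∈-link⁻ {F = F} (Vec.toList vs) A∈)

-- Union bound: each vertex of `T` lies on at most `n ^ r` of the members containing `vs`, so a
-- larger link is not blocked by `T`. With one vertex in `vs` this extends matchings; with two it
-- controls heavy pairs.
link-escape : .{{NonZero n}} → ∀ {F : Family n (suc k + r)} (vs : Vec (Vertex n (suc k + r)) k) T →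
  Unique F → Unique (Vec.toList vs) → (∀ {t} → t ∈ T → t ∉ Vec.toList vs) →
  length T * n ^ r < length (link F (Vec.toList vs)) →
  ∃ λ A → A ∈ F × All (A ∋_) (Vec.toList vs) × A avoids T
link-escape {n} {k} {r} {F} vs T F! vs! T# large with search (_avoids? T) (link F (Vec.toList vs))
... | inj₁ (A , A∈ , A#T) = let (A∈F , A∋vs) = ∈-link⁻ {F = F} (Vec.toList vs) A∈ in A , A∈F , A∋vs , A#T
... | inj₂ none = contradiction large (≤⇒≯ (covered-length (λ t → link F (t ∷ Vec.toList vs)) (n ^ r) T
    (Unique.filter⁺ _ F!) cover
    (λ t t∈ → link-bound (t ∷ vs) F! (All.tabulate (λ u∈ t≡u → T# t∈ (subst (_∈ _) (sym t≡u) u∈)) ∷ vs!))))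
  where
  cover : ∀ {A} → A ∈ link F (Vec.toList vs) → ∃ λ t → t ∈ T × A ∈ link F (t ∷ Vec.toList vs)
  cover {A} A∈ with hits-or-avoids A T
  ... | inj₁ (t , t∈ , A∋t) = let (A∈F , A∋vs) = ∈-link⁻ {F = F} (Vec.toList vs) A∈ in
    t , t∈ , ∈-link⁺ A∈F (A∋t ∷ A∋vs)
  ... | inj₂ A#T = contradiction A#T (none A∈)

-- Greedy choice: a sequence joins the matching unless it meets one already chosen. Positive
-- uniformity makes a chosen sequence meet itself.
maximal-matching : (F : Family n (suc r)) →
  ∃ λ M → IsMatching F M × (∀ {A} → A ∈ F → ∃ λ B → B ∈ M × Meet A B)
maximal-matching []      = [] , ([] , []) , λ ()
maximal-matching (A ∷ F) with maximal-matching F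
... | M , (M⊆ , M#) , max with hits-or-avoids A (concatMap vertices M)
...   | inj₁ (v , v∈ , A∋v) = let (B , B∈ , v∈B) = find (∈-concatMap⁻ vertices v∈) in
  M , (All.map there M⊆ , M#) ,
  λ { (here refl) → B , B∈ , v , A∋v , ∈-vertices⇒∋ v∈B ; (there A∈) → max A∈ }
...   | inj₂ A# = A ∷ M , (here refl ∷ All.map there M⊆ , All.tabulate disj ∷ M#) ,
  λ { (here refl) → A , here refl , (zero , lookup A zero) , hit refl , hit refl
    ; (there A∈) → let (B , B∈ , m) = max A∈ in B , there B∈ , m }
  where
  disj : ∀ {B} → B ∈ M → Disjoint A B
  disj {B} B∈ = avoids-vertices⇒disjoint A B
    (All.tabulate λ v∈ → All.lookup A# (∈-concatMap⁺ vertices (lose B∈ v∈)))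

-- Inequalities between powers of `m` and `suc m`.

bernoulli : ∀ m k → suc m ^ suc k ≤ m ^ suc k + suc k * suc m ^ k
bernoulli m zero    = ≤-reflexive (base m)
  where
  base : ∀ m → suc m * 1 ≡ m * 1 + 1
  base = solve-∀
bernoulli m (suc k) = begin
  N * N ^ suc k                                  ≤⟨ *-monoʳ-≤ N (bernoulli m k) ⟩
  N * (m * m ^ k + suc k * N ^ k)                ≡⟨ split m (m ^ k) k (N ^ k) ⟩
  m * (m * m ^ k) + (m * m ^ k + suc k * (N * N ^ k))
    ≤⟨ +-monoʳ-≤ (m ^ suc (suc k)) (+-monoˡ-≤ (suc k * N ^ suc k) (^-monoˡ-≤ (suc k) (n≤1+n m))) ⟩
  m ^ suc (suc k) + (N ^ suc k + suc k * N ^ suc k) ∎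
  where
  open ≤-Reasoning
  N = suc m
  split : ∀ m x k y → suc m * (m * x + suc k * y) ≡ m * (m * x) + (m * x + suc k * (suc m * y))
  split = solve-∀

-- The binomial expansion of `m ^ (2 + k)` in powers of `suc m`, cut after the linear term, with the
-- quadratic coefficient rounded up to a square. It shows that a Hilton-Milner family has about
-- `2 + k` times `suc m ^ (1 + k)` members.
bernoulli₂ : ∀ m k → m ^ (2 + k) + (2 + k) * suc m ^ (1 + k) ≤ suc m ^ (2 + k) + (2 + k) * (2 + k) * suc m ^ k
bernoulli₂ m zero = subst (m ^ 2 + 2 * suc m ^ 1 ≤_) (base m) (m≤m+n _ 3)
  where
  base : ∀ m → m * (m * 1) + 2 * (suc m * 1) + 3 ≡ suc m * (suc m * 1) + 4 * 1
  base = solve-∀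
-- Adding `m ^ (2 + k)` to both sides completes `m * x` to `suc m * x`, so that the induction
-- hypothesis applies.
bernoulli₂ m (suc k) = +-cancelʳ-≤ (m ^ (2 + k)) _ _ (begin
  m * x + (3 + k) * (N * y) + x                     ≡⟨ e₁ m x k y ⟩
  N * (x + (2 + k) * y) + N * y
    ≤⟨ +-mono-≤ (*-monoʳ-≤ N (bernoulli₂ m k)) (bernoulli m (suc k)) ⟩
  N * (N * y + (2 + k) * (2 + k) * z) + (x + (2 + k) * y) ≤⟨ m≤m+n _ ((3 + k) * y) ⟩
  N * (N * y + (2 + k) * (2 + k) * z) + (x + (2 + k) * y) + (3 + k) * y ≡⟨ e₂ m x k z ⟩
  N * (N * y) + (3 + k) * (3 + k) * y + x           ∎)
  where
  open ≤-Reasoning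
  N = suc m
  x = m ^ (2 + k)
  z = suc m ^ k
  y = suc m ^ (1 + k)
  e₁ : ∀ m x k y → m * x + (3 + k) * (suc m * y) + x ≡ suc m * (x + (2 + k) * y) + suc m * y
  e₁ = solve-∀
  e₂ : ∀ m x k z → suc m * (suc m * (suc m * z) + (2 + k) * (2 + k) * z) + (x + (2 + k) * (suc m * z)) + (3 + k) * (suc m * z)
       ≡ suc m * (suc m * (suc m * z)) + (3 + k) * (3 + k) * (suc m * z) + x
  e₂ = solve-∀

-- The left side is the size of twoOfThree plus m^(2+k); equality holds for k = 0 and k = 1, that is,
-- for r = 3 and r = 4 both extremal configurations have the same size.
triangle-arith : ∀ m k .{{_ : NonZero m}} →
  3 * m * suc m ^ k + suc m ^ k + m ^ (2 + k) ≤ suc m ^ (2 + k) + m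
triangle-arith m zero = ≤-reflexive (base m)
  where
  base : ∀ m → 3 * m * 1 + 1 + m * (m * 1) ≡ suc m * (suc m * 1) + m
  base = solve-∀
triangle-arith m (suc k) = +-cancelʳ-≤ (m ^ (2 + k)) _ _ (begin
  3 * m * (N * y) + N * y + m * x + x     ≡⟨ e₁ m x y ⟩
  N * (3 * m * y + y + x)                 ≤⟨ *-monoʳ-≤ N (triangle-arith m k) ⟩
  N * (N ^ (2 + k) + m)                   ≡⟨ e₂ m (N ^ (2 + k)) ⟩
  N * N ^ (2 + k) + m + m ^ 2             ≤⟨ +-monoʳ-≤ (N * N ^ (2 + k) + m) (^-monoʳ-≤ m (m≤m+n 2 k)) ⟩
  N ^ (3 + k) + m + m ^ (2 + k)           ∎)
  where
  open ≤-Reasoning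
  N = suc m
  x = m ^ (2 + k)
  y = suc m ^ k
  e₁ : ∀ m x y → 3 * m * (suc m * y) + suc m * y + m * x + x ≡ suc m * (3 * m * y + y + x)
  e₁ = solve-∀
  e₂ : ∀ m x → suc m * (x + m) ≡ suc m * x + m + m * (m * 1)
  e₂ = solve-∀

-- Excluding a value, and replacing one coordinate.

others : Fin (suc k) → List (Fin (suc k))
others {k} a = map (punchIn a) (allFin k)

length-others : (a : Fin (suc k)) → length (others a) ≡ k
length-others {k} a = trans (length-map _ (allFin k)) (length-allFin k)

others-unique : (a : Fin (suc k)) → Unique (others a)
others-unique {k} a = Unique.map⁺ (Fin.punchIn-injective a _ _) (Unique.allFin⁺ k)

∈-others⁺ : {a b : Fin (suc k)} → b ≢ a → b ∈ others a
∈-others⁺ {a = a} {b} b≢a = subst (_∈ others a) (Fin.punchIn-punchOut (b≢a ∘ sym)) (∈-map⁺ _ (∈-allFin _))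

∈-others⁻ : {a b : Fin (suc k)} → b ∈ others a → b ≢ a
∈-others⁻ {a = a} b∈ with ∈-map⁻ _ b∈
... | j , _ , refl = Fin.punchInᵢ≢i a j

replace : Seq n r → Vertex n r → Seq n r
replace A (p , a) = A [ p ]≔ a

∋-replace : (A : Seq n r) (v : Vertex n r) → replace A v ∋ v
∋-replace A (p , a) = hit (Vec.lookup∘update p A a)

replace-minimal : ∀ (A : Seq n r) v ℓ → ℓ ≢ proj₁ v → lookup (replace A v) ℓ ≡ lookup A ℓ
replace-minimal A (p , a) ℓ ℓ≢p = Vec.lookup∘update′ ℓ≢p A a

replace-∋ : ∀ {A : Seq n r} {u} v → A ∋ u → proj₁ u ≢ proj₁ v → replace A v ∋ u
replace-∋ {A = A} {u} v A∋u u≢v = hit (trans (replace-minimal A v (proj₁ u) u≢v) (at A∋u))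

replace-∋⁻ : ∀ (A : Seq n r) {u} v → replace A v ∋ u → u ≢ v → A ∋ u
replace-∋⁻ A {u} v h u≢v with proj₁ u Fin.≟ proj₁ v
... | yes eq = contradiction (∋-unique h (∋-replace A v) eq) u≢v
... | no neq = hit (trans (sym (replace-minimal A v (proj₁ u) neq)) (at h))

map-unique : (f : X → Y) {xs : List X} → Unique xs →
  (∀ {x y} → x ∈ xs → y ∈ xs → f x ≡ f y → x ≡ y) → Unique (map f xs)
map-unique f [] _ = []
map-unique f {x ∷ xs} (x≢ ∷ xs!) inj =
  All.tabulate (λ y∈ fx≡y → let (z , z∈ , eq) = ∈-map⁻ f y∈ in
    All.lookup x≢ z∈ (inj (here refl) (there z∈) (trans fx≡y eq)))
  ∷ map-unique f xs! (λ p q → inj (there p) (there q))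

replacements-unique : ∀ {A : Seq n r} {L} → Unique L → A avoids L → Unique (map (replace A) L)
replacements-unique {A = A} {L} L! A#L = map-unique (replace A) L! inj
  where
  inj : ∀ {u v} → u ∈ L → v ∈ L → replace A u ≡ replace A v → u ≡ v
  inj {u} {v} u∈ v∈ eq with u ≟ᵛ v
  ... | yes u≡v = u≡v
  ... | no u≢v  = contradiction (replace-∋⁻ A v (subst (_∋ u) eq (∋-replace A u)) u≢v) (All.lookup A#L u∈)

-- Source of the saving of `length L`: `replace A v` contains `v`, hence lies outside `G`, and
-- contains no other vertex of `L` because `A` avoids `L`. The added sequences are therefore new and
-- distinct.
add-replacements : ∀ {G : Family n r} {A L} → Unique G → (∀ {C} → C ∈ G → C avoids L) →
  Unique L → A avoids L → Unique (G ++ map (replace A) L)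
add-replacements {G = G} {A} {L} G! G#L L! A#L = Unique.++⁺ G! (replacements-unique L! A#L) disj
  where
  disj : ∀ {C} → ¬ (C ∈ G × C ∈ map (replace A) L)
  disj (C∈G , C∈) with ∈-map⁻ (replace A) C∈
  ... | v , v∈ , refl = All.lookup (G#L C∈G) v∈ (∋-replace A v)

-- With three parts available, a sequence altered in one coordinate still keeps a coordinate outside
-- the part of the centre.
third : (p q : Fin (3 + k)) → ∃ λ t → t ≢ p × t ≢ q
third zero          zero          = suc zero , (λ ()) , λ ()
third zero          (suc zero)    = suc (suc zero) , (λ ()) , λ ()
third zero          (suc (suc q)) = suc zero , (λ ()) , λ ()
third (suc zero)    zero          = suc (suc zero) , (λ ()) , λ ()
third (suc (suc p)) zero          = suc zero , (λ ()) , λ ()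
third (suc p)       (suc q)       = zero , (λ ()) , λ ()

replace-avoids : ∀ {A : Seq n r} {L v} → A avoids L → v ∉ L → replace A v avoids L
replace-avoids {A = A} {L} {v} A#L v∉L = All.tabulate λ {u} u∈ h →
  All.lookup A#L u∈ (replace-∋⁻ A v h λ { refl → v∉L u∈ })

-- The triangle configuration: at least two of three given vertices.

module Triangle (m ρ : ℕ) {x y z : Vertex (suc m) (3 + ρ)}
  (x≢y : proj₁ x ≢ proj₁ y) (x≢z : proj₁ x ≢ proj₁ z) (y≢z : proj₁ y ≢ proj₁ z) where

  box : (l₁ l₂ l₃ : List (Fin (suc m))) → Box (suc m) (3 + ρ)
  box l₁ l₂ l₃ = full [ proj₁ x ]≔ l₁ [ proj₁ y ]≔ l₂ [ proj₁ z ]≔ l₃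

  size-box : ∀ l₁ l₂ l₃ → size (box l₁ l₂ l₃) ≡ length l₁ * length l₂ * length l₃ * suc m ^ ρ
  size-box l₁ l₂ l₃ = *-cancelʳ-≡ _ _ (N * N * N) (begin
    size B₃ * (N * N * N)                ≡⟨ e₁ (size B₃) N ⟩
    size B₃ * N * N * N                  ≡⟨ cong (λ h → h * N * N) h₃ ⟩
    size B₂ * length l₃ * N * N          ≡⟨ e₂ (size B₂) (length l₃) N ⟩
    size B₂ * N * (length l₃ * N)        ≡⟨ cong (_* (length l₃ * N)) h₂ ⟩
    size B₁ * length l₂ * (length l₃ * N) ≡⟨ e₃ (size B₁) (length l₂) (length l₃) N ⟩
    size B₁ * N * (length l₂ * length l₃) ≡⟨ cong (_* (length l₂ * length l₃)) h₁ ⟩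
    N ^ (3 + ρ) * length l₁ * (length l₂ * length l₃) ≡⟨ e₄ N (N ^ ρ) (length l₁) (length l₂) (length l₃) ⟩
    length l₁ * length l₂ * length l₃ * N ^ ρ * (N * N * N) ∎)
    where
    open ≡-Reasoning
    N = suc m
    B₀ B₁ B₂ B₃ : Box (suc m) (3 + ρ)
    B₀ = full
    B₁ = B₀ [ proj₁ x ]≔ l₁
    B₂ = B₁ [ proj₁ y ]≔ l₂
    B₃ = B₂ [ proj₁ z ]≔ l₃
    len : ∀ p → length (lookup B₀ p) ≡ N
    len p = trans (cong length (lookup-full p)) (length-allFin N)
    h₁ : size B₁ * N ≡ N ^ (3 + ρ) * length l₁
    h₁ = trans (cong (size B₁ *_) (sym (len (proj₁ x))))
      (trans (size-update B₀ (proj₁ x) l₁) (cong (_* length l₁) (size-full {suc m} {3 + ρ})))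
    h₂ : size B₂ * N ≡ size B₁ * length l₂
    h₂ = trans (cong (size B₂ *_) (sym (trans (cong length (Vec.lookup∘update′ (x≢y ∘ sym) B₀ l₁)) (len (proj₁ y)))))
      (size-update B₁ (proj₁ y) l₂)
    h₃ : size B₃ * N ≡ size B₂ * length l₃
    h₃ = trans (cong (size B₃ *_) (sym (trans (cong length (trans (Vec.lookup∘update′ (y≢z ∘ sym) B₁ l₂)
        (Vec.lookup∘update′ (x≢z ∘ sym) B₀ l₁))) (len (proj₁ z)))))
      (size-update B₂ (proj₁ z) l₃)
    e₁ : ∀ a n → a * (n * n * n) ≡ a * n * n * n
    e₁ = solve-∀
    e₂ : ∀ a b n → a * b * n * n ≡ a * n * (b * n)
    e₂ = solve-∀
    e₃ : ∀ a b c n → a * b * (c * n) ≡ a * n * (b * c)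
    e₃ = solve-∀
    e₄ : ∀ n p a b c → n * (n * (n * p)) * a * (b * c) ≡ a * b * c * p * (n * n * n)
    e₄ = solve-∀

  ∈-box : ∀ (A : Seq (suc m) (3 + ρ)) l₁ l₂ l₃ → lookup A (proj₁ x) ∈ l₁ → lookup A (proj₁ y) ∈ l₂ →
    lookup A (proj₁ z) ∈ l₃ → A ∈ sequences (box l₁ l₂ l₃)
  ∈-box A l₁ l₂ l₃ p q t = ∈-sequences⁺ A (box l₁ l₂ l₃)
    (∈ᵇ-update A (full [ proj₁ x ]≔ l₁ [ proj₁ y ]≔ l₂) (proj₁ z) (λ ℓ _ → in₂ ℓ) t)
    where
    in₁ : A ∈ᵇ (full [ proj₁ x ]≔ l₁)
    in₁ = ∈ᵇ-update A full (proj₁ x) (λ ℓ _ → ∈ᵇ-full A ℓ) p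
    in₂ : A ∈ᵇ (full [ proj₁ x ]≔ l₁ [ proj₁ y ]≔ l₂)
    in₂ = ∈ᵇ-update A (full [ proj₁ x ]≔ l₁) (proj₁ y) (λ ℓ _ → in₁ ℓ) q

  only rest : Vertex (suc m) (3 + ρ) → List (Fin (suc m))
  only v = proj₂ v ∷ []
  rest v = others (proj₂ v)

  -- The boxes are split by which of the three vertices is missing, if any, so no sequence is listed
  -- twice and the length is the true size.
  twoOfThree : Family (suc m) (3 + ρ)
  twoOfThree = sequences (box (only x) (only y) (rest z)) ++ sequences (box (only x) (rest y) (only z))
    ++ sequences (box (rest x) (only y) (only z)) ++ sequences (box (only x) (only y) (only z))

  length-twoOfThree : length twoOfThree ≡ 3 * m * suc m ^ ρ + suc m ^ ρ
  length-twoOfThree = begin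
    length twoOfThree
      ≡⟨ trans (length-++ (sequences b₁)) (cong (size b₁ +_)
           (trans (length-++ (sequences b₂)) (cong (size b₂ +_) (length-++ (sequences b₃))))) ⟩
    size b₁ + (size b₂ + (size b₃ + size b₄))
      ≡⟨ cong₂ _+_ (size-box _ _ (rest z)) (cong₂ _+_ (size-box _ (rest y) _)
           (cong₂ _+_ (size-box (rest x) _ _) (size-box (only x) (only y) (only z)))) ⟩
    1 * 1 * length (rest z) * N + (1 * length (rest y) * 1 * N + (length (rest x) * 1 * 1 * N + 1 * N))
      ≡⟨ cong₂ (λ a b → 1 * 1 * a * N + b) (length-others (proj₂ z))
           (cong₂ (λ a b → 1 * a * 1 * N + b) (length-others (proj₂ y))
           (cong (λ a → a * 1 * 1 * N + 1 * N) (length-others (proj₂ x)))) ⟩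
    1 * 1 * m * N + (1 * m * 1 * N + (m * 1 * 1 * N + 1 * N))
      ≡⟨ e m N ⟩
    3 * m * N + N ∎
    where
    open ≡-Reasoning
    N = suc m ^ ρ
    b₁ = box (only x) (only y) (rest z)
    b₂ = box (only x) (rest y) (only z)
    b₃ = box (rest x) (only y) (only z)
    b₄ = box (only x) (only y) (only z)
    e : ∀ m n → 1 * 1 * m * n + (1 * m * 1 * n + (m * 1 * 1 * n + 1 * n)) ≡ 3 * m * n + n
    e = solve-∀

  -- The hypotheses have the form in which `heavy-cover` delivers them for the three pairs of a
  -- triangle.
  ∈-twoOfThree : ∀ {A} → A ∋ x ⊎ A ∋ y → A ∋ x ⊎ A ∋ z → A ∋ y ⊎ A ∋ z → A ∈ twoOfThree
  ∈-twoOfThree {A} xy xz yz with A ∋? x | A ∋? y | A ∋? z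
  ... | yes (hit a) | yes (hit b) | yes (hit c) = ∈-++⁺ʳ (sequences (box (only x) (only y) (rest z)))
    (∈-++⁺ʳ (sequences (box (only x) (rest y) (only z))) (∈-++⁺ʳ (sequences (box (rest x) (only y) (only z)))
      (∈-box A _ _ _ (here a) (here b) (here c))))
  ... | yes (hit a) | yes (hit b) | no ¬c = ∈-++⁺ˡ (∈-box A _ _ _ (here a) (here b) (∈-others⁺ (¬c ∘ hit)))
  ... | yes (hit a) | no ¬b | yes (hit c) = ∈-++⁺ʳ (sequences (box (only x) (only y) (rest z)))
    (∈-++⁺ˡ (∈-box A _ _ _ (here a) (∈-others⁺ (¬b ∘ hit)) (here c)))
  ... | no ¬a | yes (hit b) | yes (hit c) = ∈-++⁺ʳ (sequences (box (only x) (only y) (rest z)))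
    (∈-++⁺ʳ (sequences (box (only x) (rest y) (only z)))
      (∈-++⁺ˡ (∈-box A _ _ _ (∈-others⁺ (¬a ∘ hit)) (here b) (here c))))
  ... | no ¬a | no ¬b | _     = [ (λ h → contradiction h ¬a) , (λ h → contradiction h ¬b) ]′ xy
  ... | no ¬a | _     | no ¬c = [ (λ h → contradiction h ¬a) , (λ h → contradiction h ¬c) ]′ xz
  ... | _     | no ¬b | no ¬c = [ (λ h → contradiction h ¬b) , (λ h → contradiction h ¬c) ]′ yz

-- The Hilton-Milner configuration: `star` without `avoiders`, together with `spine`.

module HiltonMilner (m ρ : ℕ) {p : Fin (3 + ρ)} {a : Fin (suc m)} (B : Seq (suc m) (3 + ρ)) where

  -- When `B` misses `(p , a)`, these are the sequences through `(p , a)` that are disjoint from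
  -- `B`.
  avoiders : Box (suc m) (3 + ρ)
  avoiders = Vec.map others B [ p ]≔ (a ∷ [])

  size-avoiders : .{{NonZero m}} → size avoiders ≡ m ^ (2 + ρ)
  size-avoiders = *-cancelʳ-≡ _ _ m (begin
    size avoiders * m             ≡⟨ cong (size avoiders *_) (len p) ⟨
    size avoiders * length (lookup (Vec.map others B) p) ≡⟨ size-update (Vec.map others B) p (a ∷ []) ⟩
    size (Vec.map others B) * 1   ≡⟨ *-identityʳ (size (Vec.map others B)) ⟩
    size (Vec.map others B)       ≡⟨ size-const m (Vec.map others B) len ⟩
    m * m ^ (2 + ρ)               ≡⟨ *-comm m (m ^ (2 + ρ)) ⟩
    m ^ (2 + ρ) * m ∎)
    where
    open ≡-Reasoning
    len : ∀ q → length (lookup (Vec.map others B) q) ≡ m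
    len q = trans (cong length (Vec.lookup-map q others B)) (length-others (lookup B q))

  avoiders-unique : Unique (sequences avoiders)
  avoiders-unique = sequences-unique avoiders (update-unique (Vec.map others B) p (a ∷ [])
    (λ ℓ → subst Unique (sym (Vec.lookup-map ℓ others B)) (others-unique (lookup B ℓ))) ([] ∷ []))

  ∈-avoiders⁻ : ∀ {A} → A ∈ sequences avoiders → A ∋ (p , a) × (∀ {q} → q ≢ p → lookup A q ≢ lookup B q)
  ∈-avoiders⁻ {A} A∈ with ∈ᵇ-update⁻ˡ A (Vec.map others B) p _ (∈-sequences⁻ A avoiders A∈)
  ... | here eq = hit eq , λ {q} q≢p → ∈-others⁻ (subst (lookup A q ∈_) (Vec.lookup-map q others B)
    (∈ᵇ-update⁻ʳ A (Vec.map others B) p _ (∈-sequences⁻ A avoiders A∈) q≢p))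

  -- The Hilton-Milner members outside the star: `B` with its entry at `p` free to take any value
  -- but `a`.
  spine : Box (suc m) (3 + ρ)
  spine = Vec.map (_∷ []) B [ p ]≔ others a

  size-spine : size spine ≡ m
  size-spine = begin
    size spine                    ≡⟨ *-identityʳ (size spine) ⟨
    size spine * 1                ≡⟨ cong (size spine *_) (len p) ⟨
    size spine * length (lookup (Vec.map (_∷ []) B) p) ≡⟨ size-update (Vec.map (_∷ []) B) p (others a) ⟩
    size (Vec.map (_∷ []) B) * length (others a)
      ≡⟨ cong₂ _*_ (trans (size-const 1 (Vec.map (_∷ []) B) len) (^-zeroˡ (3 + ρ))) (length-others a) ⟩
    1 * m                         ≡⟨ *-identityˡ m ⟩
    m ∎
    where
    open ≡-Reasoning
    len : ∀ q → length (lookup (Vec.map (_∷ []) B) q) ≡ 1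
    len q = cong length (Vec.lookup-map q (_∷ []) B)

  ∈-spine : ∀ {A} → ¬ A ∋ (p , a) → (∀ q → q ≢ p → lookup A q ≡ lookup B q) → A ∈ sequences spine
  ∈-spine {A} ¬p same = ∈-sequences⁺ A spine (∈ᵇ-update A (Vec.map (_∷ []) B) p
    (λ q q≢p → subst (lookup A q ∈_) (sym (Vec.lookup-map q (_∷ []) B)) (here (same q q≢p)))
    (∈-others⁺ (¬p ∘ hit)))

  star : Box (suc m) (3 + ρ)
  star = through ((p , a) ∷ [])

  size-star : size star ≡ suc m ^ (2 + ρ)
  size-star = *-cancelʳ-≡ _ _ (suc m ^ 1) (trans (size-through ((p , a) ∷ []) ([] ∷ []))
    (e (suc m) (suc m ^ (2 + ρ))))
    where
    e : ∀ n k → n * k ≡ k * (n * 1)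
    e = solve-∀

-- Intersecting families without a one-vertex cover.

module Intersecting (m ρ : ℕ) {G : Family (suc m) (3 + ρ)} {L : List (Vertex (suc m) (3 + ρ))}
  (G! : Unique G) (meets : ∀ {A B} → A ∈ G → B ∈ G → Meet A B)
  (misses : ∀ v → ∃ λ B → B ∈ G × ¬ B ∋ v)
  (L! : Unique L) (G#L : ∀ {A} → A ∈ G → A avoids L) where

  private
    V : Set
    V = Vertex (suc m) (3 + ρ)

    -- The number of members through a pair that the `3 + ρ` vertices of one sequence can block, at
    -- `suc m ^ ρ` for each vertex.
    threshold : ℕ
    threshold = (3 + ρ) * suc m ^ ρ

  Heavy : V → V → Set
  Heavy u v = u ≢ v × threshold < length (link G (u ∷ v ∷ []))

  heavy? : ∀ u v → Dec (Heavy u v)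
  heavy? u v = ¬? (u ≟ᵛ v) ×-dec (threshold <? length (link G (u ∷ v ∷ [])))

  heavy-sym : ∀ {u v} → Heavy u v → Heavy v u
  heavy-sym {u} {v} (u≢v , large) = u≢v ∘ sym , ≤-trans large
    (unique-⊆⇒length≤ (Unique.filter⁺ _ G!) λ A∈ → swap (∈-link⁻ (u ∷ v ∷ []) A∈))
    where
    swap : ∀ {A} → A ∈ G × All (A ∋_) (u ∷ v ∷ []) → A ∈ link G (v ∷ u ∷ [])
    swap (A∈ , A∋u ∷ A∋v ∷ []) = ∈-link⁺ A∈ (A∋v ∷ A∋u ∷ [])

  heavy-escape : ∀ {u v} → Heavy u v → ∀ T → length T ≤ 3 + ρ → u ∉ T → v ∉ T →
    ∃ λ A → A ∈ G × A ∋ u × A ∋ v × A avoids T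
  heavy-escape {u} {v} (u≢v , large) T small u∉T v∉T
    with link-escape (u ∷ v ∷ []) T G! ((u≢v ∷ []) ∷ [] ∷ [])
           (λ { t∈ (here refl) → u∉T t∈ ; t∈ (there (here refl)) → v∉T t∈ })
           (≤-<-trans (*-monoˡ-≤ (suc m ^ ρ) small) large)
  ... | A , A∈ , A∋u ∷ A∋v ∷ [] , A#T = A , A∈ , A∋u , A∋v , A#T

  -- Otherwise some member through `u` and `v` would avoid every vertex of `B` and be disjoint from
  -- it.
  heavy-cover : ∀ {u v B} → Heavy u v → B ∈ G → B ∋ u ⊎ B ∋ v
  heavy-cover {u} {v} {B} uv B∈ with B ∋? u | B ∋? v
  ... | yes B∋u | _       = inj₁ B∋u
  ... | _       | yes B∋v = inj₂ B∋v
  ... | no ¬u   | no ¬v   with heavy-escape uv (vertices B) (≤-reflexive (length-vertices B))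
                                 (¬u ∘ ∈-vertices⇒∋) (¬v ∘ ∈-vertices⇒∋)
  ...   | A , A∈ , _ , _ , A#B =
    contradiction (avoids-vertices⇒disjoint A B A#B) (¬meet∧disjoint (meets A∈ B∈))

  -- Otherwise some member through `w` and `z` would avoid both `u` and `v`, against `heavy-cover`.
  heavy-meet : ∀ {u v w z} → Heavy u v → Heavy w z → (u ≡ w ⊎ u ≡ z) ⊎ (v ≡ w ⊎ v ≡ z)
  heavy-meet {u} {v} {w} {z} uv wz with (u ≟ᵛ w) ⊎-dec (u ≟ᵛ z) | (v ≟ᵛ w) ⊎-dec (v ≟ᵛ z)
  ... | yes h | _     = inj₁ h
  ... | _     | yes h = inj₂ h
  ... | no ¬u | no ¬v with heavy-escape wz (u ∷ v ∷ []) (s≤s (s≤s z≤n))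
                             (λ { (here eq) → ¬u (inj₁ (sym eq)) ; (there (here eq)) → ¬v (inj₁ (sym eq)) })
                             (λ { (here eq) → ¬u (inj₂ (sym eq)) ; (there (here eq)) → ¬v (inj₂ (sym eq)) })
  ...   | A , A∈ , _ , _ , ¬A∋u ∷ ¬A∋v ∷ [] with heavy-cover uv A∈
  ...     | inj₁ A∋u = contradiction A∋u ¬A∋u
  ...     | inj₂ A∋v = contradiction A∋v ¬A∋v

  heavy-member : ∀ {u v} → Heavy u v → ∃ λ A → A ∈ G × A ∋ u × A ∋ v
  heavy-member uv = let (A , A∈ , A∋u , A∋v , _) = heavy-escape uv [] z≤n (λ ()) (λ ()) in A , A∈ , A∋u , A∋v

  heavy-parts : ∀ {u v} → Heavy u v → proj₁ u ≢ proj₁ v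
  heavy-parts uv eq = let (_ , _ , A∋u , A∋v) = heavy-member uv in proj₁ uv (∋-unique A∋u A∋v eq)

  heavy-∉L : ∀ {u v} → Heavy u v → u ∉ L
  heavy-∉L uv u∈ = let (_ , A∈ , A∋u , _) = heavy-member uv in All.lookup (G#L A∈) u∈ A∋u

  -- Every A in G meets B₀ in some vertex u, and meets missing u in a vertex other than u, so A contains
  -- one of only (3 + ρ)² pairs.
  missing : V → Seq (suc m) (3 + ρ)
  missing = proj₁ ∘ misses

  -- The vertex is arbitrary; it serves to obtain some member of `G`.
  B₀ : Seq (suc m) (3 + ρ)
  B₀ = missing (zero , zero)

  Index : Set
  Index = Fin (3 + ρ) × Fin (3 + ρ)

  first second : Index → V
  first  (ℓ , _)  = ℓ , lookup B₀ ℓ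
  second (ℓ , ℓ′) = ℓ′ , lookup (missing (first (ℓ , ℓ′))) ℓ′

  bundle : Index → Family (suc m) (3 + ρ)
  bundle i = link G (first i ∷ second i ∷ [])

  light? : ∀ i → Dec (length (bundle i) ≤ threshold)
  light? i = length (bundle i) ≤? threshold

  lightIndices : List Index
  lightIndices = filter light? (cartesianProduct (allFin (3 + ρ)) (allFin (3 + ρ)))

  length-lightIndices : length lightIndices ≤ (3 + ρ) * (3 + ρ)
  length-lightIndices = ≤-trans (length-filter light? (cartesianProduct (allFin (3 + ρ)) (allFin (3 + ρ))))
    (≤-reflexive (trans (length-cartesianProductWith _,_ (allFin (3 + ρ)) (allFin (3 + ρ)))
      (cong₂ _*_ (length-allFin (3 + ρ)) (length-allFin (3 + ρ)))))

  light-or-heavy : ∀ {A} → A ∈ G →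
    (∃ λ i → i ∈ lightIndices × A ∈ bundle i) ⊎ (∃ λ u → ∃ λ v → Heavy u v × A ∋ u × A ∋ v)
  light-or-heavy {A} A∈ with meets A∈ (proj₁ (proj₂ (misses (zero , zero))))
  ... | u@(ℓ , _) , A∋u , hit refl with meets A∈ (proj₁ (proj₂ (misses u)))
  ...   | v@(ℓ′ , _) , A∋v , hit refl with light? (ℓ , ℓ′)
  ...     | yes light = inj₁ ((ℓ , ℓ′) , ∈-filter⁺ light? (∈-cartesianProduct⁺ (∈-allFin ℓ) (∈-allFin ℓ′)) light ,
                               ∈-link⁺ A∈ (A∋u ∷ A∋v ∷ []))
  ...     | no ¬light = inj₂ (u , v , (u≢v , ≰⇒> ¬light) , A∋u , A∋v)
    where
    -- `v` lies on `missing u`, whereas `u` does not.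
    u≢v : u ≢ v
    u≢v eq = proj₂ (proj₂ (misses u)) (subst (missing u ∋_) (sym eq) (hit refl))

  -- If no pair is heavy, every vertex is vacuously a centre, so that situation is part of the star
  -- case.
  IsCentre : V → Set
  IsCentre x = ∀ {u v} → Heavy u v → x ≡ u ⊎ x ≡ v

  centre-or-other : ∀ x → IsCentre x ⊎ (∃ λ u → ∃ λ v → Heavy u v × x ≢ u × x ≢ v)
  centre-or-other x with search (λ (u , v) → heavy? u v ×-dec (¬? (x ≟ᵛ u) ×-dec ¬? (x ≟ᵛ v)))
                              (cartesianProduct allVertices allVertices)
  ... | inj₁ ((u , v) , _ , h) = inj₂ (u , v , h)
  ... | inj₂ none = inj₁ centre
    where
    centre : IsCentre x
    centre {u} {v} uv with x ≟ᵛ u | x ≟ᵛ v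
    ... | yes eq | _      = inj₁ eq
    ... | _      | yes eq = inj₂ eq
    ... | no ¬u  | no ¬v  = contradiction (uv , ¬u , ¬v)
      (none (∈-cartesianProduct⁺ (∈-allVertices u) (∈-allVertices v)))

  -- Pairwise meeting edges form a star or a triangle. If neither end of a heavy pair `x`, `y` is a
  -- centre, a heavy pair missing `x` must contain `y`, one missing `y` must contain `x`, and these
  -- two can meet only in a common third vertex.
  centre-or-triangle : (∃ IsCentre) ⊎ (∃ λ x → ∃ λ y → ∃ λ z → Heavy x y × Heavy x z × Heavy y z)
  -- Testing an arbitrary vertex either shows it to be a centre or produces a first heavy pair.
  centre-or-triangle with centre-or-other (zero , zero)
  ... | inj₁ c = inj₁ (_ , c)
  ... | inj₂ (x , y , xy , _) with centre-or-other x | centre-or-other y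
  ...   | inj₁ c | _ = inj₁ (x , c)
  ...   | _ | inj₁ c = inj₁ (y , c)
  ...   | inj₂ (u , v , uv , x≢u , x≢v) | inj₂ (u′ , v′ , uv′ , y≢u′ , y≢v′) = inj₂ (x , y , triangle)
    where
    through-y : ∃ λ z → Heavy y z × x ≢ z
    through-y with heavy-meet xy uv
    ... | inj₁ (inj₁ eq)   = contradiction eq x≢u
    ... | inj₁ (inj₂ eq)   = contradiction eq x≢v
    ... | inj₂ (inj₁ refl) = v , uv , x≢v
    ... | inj₂ (inj₂ refl) = u , heavy-sym uv , x≢u

    through-x : ∃ λ z → Heavy x z × y ≢ z
    through-x with heavy-meet xy uv′
    ... | inj₁ (inj₁ refl) = v′ , uv′ , y≢v′
    ... | inj₁ (inj₂ refl) = u′ , heavy-sym uv′ , y≢u′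
    ... | inj₂ (inj₁ eq)   = contradiction eq y≢u′
    ... | inj₂ (inj₂ eq)   = contradiction eq y≢v′

    triangle : ∃ λ z → Heavy x y × Heavy x z × Heavy y z
    triangle with through-y | through-x
    ... | z , yz , x≢z | z′ , xz′ , y≢z′ with heavy-meet yz xz′
    ...   | inj₁ (inj₁ eq)   = contradiction (sym eq) (proj₁ xy)
    ...   | inj₁ (inj₂ eq)   = contradiction eq y≢z′
    ...   | inj₂ (inj₁ eq)   = contradiction (sym eq) x≢z
    ...   | inj₂ (inj₂ refl) = z , xy , xz′ , yz

  -- By `heavy-cover`, `twoOfThree` contains `G`; it also contains one further sequence for each
  -- vertex of `L`. `triangle-arith` compares its size with that of a Hilton-Milner family.
  triangle-bound : .{{NonZero m}} → ∀ {x y z} → Heavy x y → Heavy x z → Heavy y z →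
    length G + length L + m ^ (2 + ρ) ≤ suc m ^ (2 + ρ) + m
  triangle-bound {x} {y} {z} xy xz yz = begin
    length G + length L + m ^ (2 + ρ)
      ≡⟨ cong (_+ m ^ (2 + ρ)) (trans (length-++ G) (cong (length G +_) (length-map (replace base) L))) ⟨
    length (G ++ map (replace base) L) + m ^ (2 + ρ)
      ≤⟨ +-monoˡ-≤ (m ^ (2 + ρ)) (unique-⊆⇒length≤ (add-replacements G! G#L L! base#L) within) ⟩
    length twoOfThree + m ^ (2 + ρ)                  ≡⟨ cong (_+ m ^ (2 + ρ)) length-twoOfThree ⟩
    3 * m * suc m ^ ρ + suc m ^ ρ + m ^ (2 + ρ)      ≤⟨ triangle-arith m ρ ⟩
    suc m ^ (2 + ρ) + m ∎
    where
    open ≤-Reasoning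
    open Triangle m ρ {x} {y} {z} (heavy-parts xy) (heavy-parts xz) (heavy-parts yz)
    base : Seq (suc m) (3 + ρ)
    -- All three triangle vertices lie on `base`, so changing one coordinate loses at most one of
    -- them. Starting from a member of `G` keeps it off `L`.
    base = replace (replace (replace B₀ x) y) z
    base∋z : base ∋ z
    base∋z = ∋-replace (replace (replace B₀ x) y) z
    base∋y : base ∋ y
    base∋y = replace-∋ z (∋-replace (replace B₀ x) y) (heavy-parts yz)
    base∋x : base ∋ x
    base∋x = replace-∋ z (replace-∋ y (∋-replace B₀ x) (heavy-parts xy)) (heavy-parts xz)
    base#L : base avoids L
    base#L = replace-avoids (replace-avoids (replace-avoids (G#L (proj₁ (proj₂ (misses _))))
      (heavy-∉L xy)) (heavy-∉L yz)) (heavy-∉L (heavy-sym xz))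
    one-kept : ∀ {u w} v → proj₁ u ≢ proj₁ w → base ∋ u → base ∋ w → replace base v ∋ u ⊎ replace base v ∋ w
    one-kept {u} v u≢w b∋u b∋w with proj₁ u Fin.≟ proj₁ v
    ... | no u≢v   = inj₁ (replace-∋ v b∋u u≢v)
    ... | yes u≡v = inj₂ (replace-∋ v b∋w λ w≡v → u≢w (trans u≡v (sym w≡v)))
    within : G ++ map (replace base) L ⊆ twoOfThree
    within A∈ with ∈-++⁻ G A∈
    ... | inj₁ A∈G = ∈-twoOfThree (heavy-cover xy A∈G) (heavy-cover xz A∈G) (heavy-cover yz A∈G)
    ... | inj₂ A∈r with ∈-map⁻ (replace base) A∈r
    ...   | v , _ , refl = ∈-twoOfThree (one-kept v (heavy-parts xy) base∋x base∋y)
      (one-kept v (heavy-parts xz) base∋x base∋z) (one-kept v (heavy-parts yz) base∋y base∋z)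

  module Centred {x : V} (centre : IsCentre x) where
    p = proj₁ x
    B = missing x
    B∈ = proj₁ (proj₂ (misses x))
    B∌x = proj₂ (proj₂ (misses x))

    partner : Fin (3 + ρ) → V
    partner q = q , lookup B q

    -- By heavy-cover the heavy partners of the centre x lie on B; if one coordinate of B is not a
    -- partner, G lies in 1 + ρ = r - 2 spokes up to the light bundles.
    unsaturated-bound : ∀ {q₀} → q₀ ≢ p → ¬ Heavy x (partner q₀) →
      length G ≤ (1 + ρ) * suc m ^ (1 + ρ) + (3 + ρ) * (3 + ρ) * threshold
    unsaturated-bound {q₀} q₀≢p ¬heavy = begin
      length G ≤⟨ unique-⊆⇒length≤ G! cover ⟩
      length (concatMap spoke spokes ++ concatMap bundle lightIndices)
        ≡⟨ length-++ (concatMap spoke spokes) ⟩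
      length (concatMap spoke spokes) + length (concatMap bundle lightIndices)
        ≤⟨ +-mono-≤ (length-concatMap spoke _ spokes spoke-bound) (length-concatMap bundle threshold lightIndices
             λ i i∈ → proj₂ (∈-filter⁻ light? {xs = cartesianProduct (allFin (3 + ρ)) (allFin (3 + ρ))} i∈)) ⟩
      length spokes * suc m ^ (1 + ρ) + length lightIndices * threshold
        ≤⟨ +-mono-≤ (*-monoˡ-≤ (suc m ^ (1 + ρ)) length-spokes) (*-monoˡ-≤ threshold length-lightIndices) ⟩
      (1 + ρ) * suc m ^ (1 + ρ) + (3 + ρ) * (3 + ρ) * threshold ∎
      where
      open ≤-Reasoning
      spoke? : ∀ q → Dec (q ≢ p × q ≢ q₀)
      spoke? q = ¬? (q Fin.≟ p) ×-dec ¬? (q Fin.≟ q₀)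
      spokes : List (Fin (3 + ρ))
      spokes = filter spoke? (allFin (3 + ρ))
      ∈-spokes⁻ : ∀ {q} → q ∈ spokes → q ≢ p × q ≢ q₀
      ∈-spokes⁻ q∈ = proj₂ (∈-filter⁻ spoke? {xs = allFin (3 + ρ)} q∈)
      spoke : Fin (3 + ρ) → Family (suc m) (3 + ρ)
      spoke q = link G (x ∷ partner q ∷ [])
      spoke-bound : ∀ q → q ∈ spokes → length (spoke q) ≤ suc m ^ (1 + ρ)
      spoke-bound q q∈ = link-bound (x ∷ partner q ∷ []) G!
        (((λ eq → proj₁ (∈-spokes⁻ q∈) (sym (cong proj₁ eq))) ∷ []) ∷ [] ∷ [])
      length-spokes : length spokes ≤ 1 + ρ
      length-spokes = s≤s⁻¹ (s≤s⁻¹ (subst (length (p ∷ q₀ ∷ spokes) ≤_) (length-allFin (3 + ρ))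
        (unique-⊆⇒length≤
          (((q₀≢p ∘ sym) ∷ All.tabulate (λ q∈ eq → proj₁ (∈-spokes⁻ q∈) (sym eq)))
            ∷ All.tabulate (λ q∈ eq → proj₂ (∈-spokes⁻ q∈) (sym eq)) ∷ Unique.filter⁺ spoke? (Unique.allFin⁺ _))
          λ {q} _ → ∈-allFin q)))
      on-spoke : ∀ {A w} → A ∈ G → Heavy x w → A ∋ x → A ∋ w → ∃ λ q → q ∈ spokes × A ∈ spoke q
      on-spoke {A} {w} A∈ xw A∋x A∋w with heavy-cover xw B∈
      ... | inj₁ B∋x = contradiction B∋x B∌x
      ... | inj₂ (hit refl) = proj₁ w , ∈-filter⁺ spoke? (∈-allFin (proj₁ w))
        ((λ eq → heavy-parts xw (sym eq)) , λ { refl → ¬heavy xw }) , ∈-link⁺ A∈ (A∋x ∷ A∋w ∷ [])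
      cover : G ⊆ concatMap spoke spokes ++ concatMap bundle lightIndices
      cover {A} A∈ with light-or-heavy A∈
      ... | inj₁ (i , i∈ , A∈i) = ∈-++⁺ʳ (concatMap spoke spokes) (∈-concatMap⁺ bundle (lose i∈ A∈i))
      ... | inj₂ (u , v , uv , A∋u , A∋v) = ∈-++⁺ˡ (in-spoke (centre uv))
        where
        in-spoke : x ≡ u ⊎ x ≡ v → A ∈ concatMap spoke spokes
        in-spoke (inj₁ refl) = let (q , q∈ , A∈q) = on-spoke A∈ uv A∋u A∋v in ∈-concatMap⁺ spoke (lose q∈ A∈q)
        in-spoke (inj₂ refl) = let (q , q∈ , A∈q) = on-spoke A∈ (heavy-sym uv) A∋v A∋u in
          ∈-concatMap⁺ spoke (lose q∈ A∈q)

    -- A member of `G` through `x` meets `B`, hence is no avoider; one missing `x` contains every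
    -- partner by `heavy-cover`, hence lies on the spine. The replacements of `base` obey the same
    -- restrictions. Putting the avoiders on the left makes the comparison subtraction-free.
    saturated-bound : .{{NonZero m}} → (∀ {q} → q ≢ p → Heavy x (partner q)) →
      length G + length L + m ^ (2 + ρ) ≤ suc m ^ (2 + ρ) + m
    saturated-bound heavy = begin
      length G + length L + m ^ (2 + ρ)
        ≡⟨ cong₂ _+_ (trans (length-++ G) (cong (length G +_) (length-map (replace base) L))) size-avoiders ⟨
      length (G ++ map (replace base) L) + size avoiders
        ≡⟨ length-++ (G ++ map (replace base) L) ⟨
      length ((G ++ map (replace base) L) ++ sequences avoiders)
        ≤⟨ unique-⊆⇒length≤ (Unique.++⁺ (add-replacements G! G#L L! base#L) avoiders-unique apart) within ⟩
      length (sequences star ++ sequences spine)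
        ≡⟨ trans (length-++ (sequences star)) (cong₂ _+_ size-star size-spine) ⟩
      suc m ^ (2 + ρ) + m ∎
      where
      open ≤-Reasoning
      open HiltonMilner m ρ {p} {proj₂ x} B
      base : Seq (suc m) (3 + ρ)
      base = replace B x
      base∋x : base ∋ x
      base∋x = ∋-replace B x
      base∋ : ∀ {q} → q ≢ p → base ∋ partner q
      base∋ {q} q≢p = hit (replace-minimal B x q q≢p)
      base#L : base avoids L
      -- `third p p` just supplies a part other than `p`, whose partner forms a heavy pair with `x`;
      -- hence `x` is not in `L`.
      base#L = replace-avoids (G#L B∈) (heavy-∉L (heavy (proj₁ (proj₂ (third p p)))))
      apart : ∀ {A} → ¬ (A ∈ G ++ map (replace base) L × A ∈ sequences avoiders)
      apart {A} (A∈ , A∈av) with ∈-avoiders⁻ A∈av | ∈-++⁻ G A∈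
      ... | A∋x , A≢B | inj₁ A∈G with meets A∈G B∈
      ...   | (q , _) , hit refl , hit eq with q Fin.≟ p
      ...     | yes refl = B∌x (hit (trans eq (at A∋x)))
      ...     | no q≢p   = A≢B q≢p (sym eq)
      apart {A} (A∈ , A∈av) | A∋x , A≢B | inj₂ A∈r with ∈-map⁻ (replace base) A∈r
      ...   | v , _ , refl with third p (proj₁ v)
      ...     | t , t≢p , t≢v = A≢B t≢p (at (replace-∋ v (base∋ t≢p) t≢v))
      in-star : ∀ {A} → A ∋ x → A ∈ sequences star ++ sequences spine
      in-star {A} A∋x = ∈-++⁺ˡ (∈-sequences⁺ A star (∈-through (x ∷ []) (A∋x ∷ [])))
      in-spine : ∀ {A} → ¬ A ∋ x → (∀ {q} → q ≢ p → A ∋ partner q) → A ∈ sequences star ++ sequences spine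
      in-spine A∌x h = ∈-++⁺ʳ (sequences star) (∈-spine A∌x λ q q≢p → at (h q≢p))
      within : (G ++ map (replace base) L) ++ sequences avoiders ⊆ sequences star ++ sequences spine
      within {A} A∈ with ∈-++⁻ (G ++ map (replace base) L) A∈
      ... | inj₂ A∈av = in-star (proj₁ (∈-avoiders⁻ A∈av))
      ... | inj₁ A∈′ with A ∋? x | ∈-++⁻ G A∈′
      ...   | yes A∋x | _ = in-star A∋x
      ...   | no A∌x | inj₁ A∈G = in-spine A∌x λ q≢p →
        [ (λ h → contradiction h A∌x) , id ]′ (heavy-cover (heavy q≢p) A∈G)
      ...   | no A∌x | inj₂ A∈r with ∈-map⁻ (replace base) A∈r
      ...     | v , _ , refl with p Fin.≟ proj₁ v
      ...       | no p≢v   = contradiction (replace-∋ v base∋x p≢v) A∌x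
      -- A replacement in the part of `x` loses `x` but keeps all partners.
      ...       | yes refl = in-spine A∌x λ q≢p → replace-∋ v (base∋ q≢p) q≢p

    saturated? : (∀ {q} → q ≢ p → Heavy x (partner q)) ⊎ (∃ λ q → q ≢ p × ¬ Heavy x (partner q))
    saturated? with search (λ q → ¬? (q Fin.≟ p) ×-dec ¬? (heavy? x (partner q))) (allFin (3 + ρ))
    ... | inj₁ (q , _ , h) = inj₂ (q , h)
    ... | inj₂ none = inj₁ heavy
      where
      heavy : ∀ {q} → q ≢ p → Heavy x (partner q)
      heavy {q} q≢p with heavy? x (partner q)
      ... | yes h = h
      ... | no ¬h = contradiction (q≢p , ¬h) (none (∈-allFin q))

  bound : .{{NonZero m}} → length L ≤ m → (3 + ρ) * (3 + ρ) * (3 + ρ) + (2 + ρ) * (2 + ρ) ≤ suc m →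
    length G + length L + m ^ (2 + ρ) ≤ suc m ^ (2 + ρ) + m
  bound L≤m large with centre-or-triangle
  ... | inj₂ (x , y , z , xy , xz , yz) = triangle-bound xy xz yz
  ... | inj₁ (x , centre) with Centred.saturated? centre
  ...   | inj₁ heavy = Centred.saturated-bound centre heavy
  -- `suc m * P`, the size of one more spoke, is added to both sides. A Hilton-Milner family has
  -- about `2 + ρ` spokes against the `1 + ρ` containing `G`, and `large` lets the spare one absorb
  -- the light bundles (`R * R * R`) and the error of `bernoulli₂` (`S * S`).
  ...   | inj₂ (q , q≢p , ¬heavy) = +-cancelʳ-≤ (suc m * P) _ _ (begin
    length G + length L + M + N * P
      ≤⟨ +-monoˡ-≤ (N * P) (+-monoˡ-≤ M (+-mono-≤ (Centred.unsaturated-bound centre q≢p ¬heavy) L≤m)) ⟩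
    (1 + ρ) * (N * P) + R * R * (R * P) + m + M + N * P     ≡⟨ e₁ ρ (N * P) R P m M ⟩
    M + (2 + ρ) * (N * P) + (R * R * R * P + m)             ≤⟨ +-monoˡ-≤ _ (bernoulli₂ m ρ) ⟩
    N ^ (2 + ρ) + S * S * P + (R * R * R * P + m)           ≡⟨ e₂ (N ^ (2 + ρ)) S P R m ⟩
    N ^ (2 + ρ) + m + (R * R * R + S * S) * P
      ≤⟨ +-monoʳ-≤ (N ^ (2 + ρ) + m) (*-monoˡ-≤ P large) ⟩
    N ^ (2 + ρ) + m + N * P                                 ∎)
    where
    open ≤-Reasoning
    N = suc m
    P = suc m ^ ρ
    M = m ^ (2 + ρ)
    R = 3 + ρ
    S = 2 + ρ
    e₁ : ∀ ρ q t p m k → (1 + ρ) * q + t * t * (t * p) + m + k + q ≡ k + (2 + ρ) * q + (t * t * t * p + m)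
    e₁ = solve-∀
    e₂ : ∀ k s p t m → k + s * s * p + (t * t * t * p + m) ≡ k + m + (t * t * t + s * s) * p
    e₂ = solve-∀

-- The upper bound, by the number of big vertices.

module UpperBound (m ρ σ : ℕ) {F : Family (suc m) (3 + ρ)} (admissible : Admissible (2 + σ) (suc m) (3 + ρ) F) where

  private
    V : Set
    V = Vertex (suc m) (3 + ρ)

    F! : Unique F
    F! = proj₁ admissible

    ν≤ : NuAtMost (2 + σ) F
    ν≤ = proj₁ (proj₂ admissible)

    τ> : TauAbove (2 + σ) F
    τ> = proj₂ (proj₂ admissible)

  -- Bounds the number of vertices to be avoided when extending a matching: at most `3 + σ` further
  -- big vertices, and `3 + ρ` on each of at most `2 + σ` members.
  capacity : ℕ
  capacity = (3 + σ) + (2 + σ) * (3 + ρ)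

  Big : V → Set
  Big v = capacity * suc m ^ (1 + ρ) < length (link F (v ∷ []))

  big? : ∀ v → Dec (Big v)
  big? v = capacity * suc m ^ (1 + ρ) <? length (link F (v ∷ []))

  length-matching-vertices : ∀ {M} → IsMatching F M → length (concatMap vertices M) ≤ (2 + σ) * (3 + ρ)
  length-matching-vertices {M} M-matching = ≤-trans
    (length-concatMap vertices (3 + ρ) M (λ A _ → ≤-reflexive (length-vertices A)))
    (*-monoˡ-≤ (3 + ρ) (ν≤ M M-matching))

  -- Each big vertex in turn receives a member through it that avoids the current matching and the
  -- big vertices still waiting.
  extend-matching : ∀ U M → length U ≤ 3 + σ → Unique U → All Big U → IsMatching F M →
    All (_avoids U) M → length M + length U ≤ 2 + σ
  extend-matching [] M _ _ _ M-matching _ = subst (_≤ 2 + σ) (sym (+-identityʳ (length M))) (ν≤ M M-matching)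
  extend-matching (u ∷ U) M U≤ (u∉U ∷ U!) (big ∷ bigs) M-matching M#
    with link-escape (u ∷ []) (U ++ concatMap vertices M) F! ([] ∷ []) fresh
           (≤-<-trans (*-monoˡ-≤ (suc m ^ (1 + ρ)) (subst (_≤ capacity) (sym (length-++ U))
             (+-mono-≤ (≤-trans (n≤1+n (length U)) U≤) (length-matching-vertices M-matching)))) big)
    where
    fresh : ∀ {t} → t ∈ U ++ concatMap vertices M → t ∉ u ∷ []
    fresh t∈ (here refl) with ∈-++⁻ U t∈
    ... | inj₁ t∈U = All.lookup u∉U t∈U refl
    ... | inj₂ t∈M = let (B , B∈ , t∈B) = find (∈-concatMap⁻ vertices t∈M) in
      All.head (All.lookup M# B∈) (∈-vertices⇒∋ t∈B)
  ... | A , A∈ , _ , A# = subst (_≤ 2 + σ) (sym (+-suc (length M) (length U)))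
    (extend-matching U (A ∷ M) (≤-trans (n≤1+n (length U)) U≤) U! bigs
      (A∈ ∷ proj₁ M-matching , All.tabulate disj ∷ proj₂ M-matching)
      (All.tabulate (λ t∈ → All.lookup A# (∈-++⁺ˡ t∈)) ∷ All.map All.tail M#))
    where
    disj : ∀ {B} → B ∈ M → Disjoint A B
    disj {B} B∈ = avoids-vertices⇒disjoint A B (All.tabulate λ v∈ →
      All.lookup A# (∈-++⁺ʳ U (∈-concatMap⁺ vertices (lose B∈ v∈))))

  L : List V
  L = filter big? allVertices

  L! : Unique L
  L! = Unique.filter⁺ big? (allVertices-unique {suc m} {3 + ρ})

  ∈-L⁻ : ∀ {v} → v ∈ L → Big v
  ∈-L⁻ v∈ = proj₂ (∈-filter⁻ big? {xs = allVertices} v∈)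

  -- Otherwise `3 + σ` of the big vertices would extend the empty matching beyond the allowed size.
  length-L : length L ≤ 2 + σ
  length-L with length L ≤? 2 + σ
  ... | yes L≤ = L≤
  ... | no L≰ = contradiction
    (extend-matching (take (3 + σ) L) [] (≤-reflexive exact) (Unique.take⁺ (3 + σ) L!)
      (All.take⁺ (3 + σ) (All.tabulate ∈-L⁻)) ([] , []) [])
    (<⇒≱ (≤-reflexive (sym exact)))
    where
    exact : length (take (3 + σ) L) ≡ 3 + σ
    exact = trans (length-take (3 + σ) L) (m≤n⇒m⊓n≡m (≰⇒> L≰))

  remainder : Family (suc m) (3 + ρ)
  remainder = filter (_avoids? L) F

  ∈-remainder⁺ : ∀ {A} → A ∈ F → A avoids L → A ∈ remainder
  ∈-remainder⁺ = ∈-filter⁺ (_avoids? L)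

  ∈-remainder⁻ : ∀ {A} → A ∈ remainder → A ∈ F × A avoids L
  ∈-remainder⁻ = ∈-filter⁻ (_avoids? L) {xs = F}

  remainder-matching : ∀ {M} → IsMatching remainder M → IsMatching F M
  remainder-matching (M⊆ , M#) = All.map (proj₁ ∘ ∈-remainder⁻) M⊆ , M#

  length-remainder-matching : ∀ {M} → IsMatching remainder M → length M + length L ≤ 2 + σ
  length-remainder-matching {M} M-matching = extend-matching L M (≤-trans length-L (n≤1+n _)) L!
    (All.tabulate ∈-L⁻) (remainder-matching M-matching) (All.map (proj₂ ∘ ∈-remainder⁻) (proj₁ M-matching))

  length-F : length F ≤ length L * suc m ^ (2 + ρ) + length remainder
  length-F = begin
    length F
      ≤⟨ unique-⊆⇒length≤ F! cover ⟩
    length (concatMap (λ v → link F (v ∷ [])) L ++ remainder)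
      ≡⟨ length-++ (concatMap (λ v → link F (v ∷ [])) L) ⟩
    length (concatMap (λ v → link F (v ∷ [])) L) + length remainder
      ≤⟨ +-monoˡ-≤ _ (length-concatMap (λ v → link F (v ∷ [])) _ L λ v _ → link-bound (v ∷ []) F! ([] ∷ [])) ⟩
    length L * suc m ^ (2 + ρ) + length remainder ∎
    where
    open ≤-Reasoning
    cover : F ⊆ concatMap (λ v → link F (v ∷ [])) L ++ remainder
    cover {A} A∈ with hits-or-avoids A L
    ... | inj₁ (v , v∈ , A∋v) = ∈-++⁺ˡ (∈-concatMap⁺ (λ v → link F (v ∷ [])) (lose v∈ (∈-link⁺ A∈ (A∋v ∷ []))))
    ... | inj₂ A# = ∈-++⁺ʳ (concatMap (λ v → link F (v ∷ [])) L) (∈-remainder⁺ A∈ A#)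

  -- The vertices of a maximal matching of `remainder` cover it, and none of them is big, since they
  -- lie on members avoiding `L`.
  length-remainder : length remainder ≤ (2 + σ) * (3 + ρ) * (capacity * suc m ^ (1 + ρ))
  length-remainder with maximal-matching remainder
  ... | M , M-matching , maximal = ≤-trans
    (covered-length (λ v → link F (v ∷ [])) _ (concatMap vertices M) (Unique.filter⁺ (_avoids? L) F!) cover small)
    (*-monoˡ-≤ _ (length-matching-vertices (remainder-matching M-matching)))
    where
    cover : ∀ {A} → A ∈ remainder → ∃ λ v → v ∈ concatMap vertices M × A ∈ link F (v ∷ [])
    cover A∈ = let (B , B∈ , v , A∋v , B∋v) = maximal A∈ in
      v , ∈-concatMap⁺ vertices (lose B∈ (∋⇒∈-vertices B∋v)) , ∈-link⁺ (proj₁ (∈-remainder⁻ A∈)) (A∋v ∷ [])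
    small : ∀ v → v ∈ concatMap vertices M → length (link F (v ∷ [])) ≤ capacity * suc m ^ (1 + ρ)
    small v v∈ with big? v
    ... | no ¬big = ≮⇒≥ ¬big
    ... | yes big = let (B , B∈ , v∈B) = find (∈-concatMap⁻ vertices v∈) in
      contradiction (∈-vertices⇒∋ v∈B)
        (All.lookup (proj₂ (∈-remainder⁻ (All.lookup (proj₁ M-matching) B∈))) (∈-filter⁺ big? (∈-allVertices v) big))

  uncovered : ∀ T → length T ≤ 2 + σ → ∃ λ A → A ∈ F × A avoids T
  uncovered T T≤ with search (_avoids? T) F
  ... | inj₁ h = h
  ... | inj₂ none = contradiction (τ> T (All.tabulate covered)) (≤⇒≯ T≤)
    where
    covered : ∀ {A} → A ∈ F → ∃ λ ℓ → (ℓ , lookup A ℓ) ∈ T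
    covered {A} A∈ with hits-or-avoids A T
    ... | inj₁ ((ℓ , _) , v∈ , hit refl) = ℓ , v∈
    ... | inj₂ A# = contradiction A# (none A∈)

  -- `L` is too short to be a transversal, so some member avoids it; that member alone is a matching
  -- which all of `L` extends.
  length-L≤1+σ : length L ≤ 1 + σ
  length-L≤1+σ = let (A , A∈ , A#) = uncovered L length-L in
    s≤s⁻¹ (length-remainder-matching {A ∷ []} (∈-remainder⁺ A∈ A# ∷ [] , [] ∷ []))

  -- Additive form of the bound with `n = suc m`, free of truncated subtraction.
  upper-bound : .{{NonZero m}} → (2 + σ) * (3 + ρ) * capacity ≤ suc m → 1 + σ ≤ m →
    (3 + ρ) * (3 + ρ) * (3 + ρ) + (2 + ρ) * (2 + ρ) ≤ suc m →
    length F + (2 + σ) + m ^ (2 + ρ) ≤ (2 + σ) * suc m ^ (2 + ρ) + suc m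
  upper-bound large₁ large₂ large₃ with m≤n⇒m<n∨m≡n length-L≤1+σ
  -- At most `σ` stars occur; `large₁` bounds the remainder by one further `K`, and `m ^ (2 + ρ)`
  -- costs the last.
  ... | inj₁ L<1+σ = begin
    length F + (2 + σ) + m ^ (2 + ρ)
      ≤⟨ +-mono-≤ (+-mono-≤ (≤-trans length-F (+-mono-≤ (*-monoˡ-≤ _ (s≤s⁻¹ L<1+σ)) length-remainder))
             (s≤s large₂)) (^-monoˡ-≤ (2 + ρ) (n≤1+n m)) ⟩
    σ * K + (2 + σ) * (3 + ρ) * (capacity * suc m ^ (1 + ρ)) + suc m + K
      ≡⟨ cong (λ h → σ * K + h + suc m + K) (*-assoc ((2 + σ) * (3 + ρ)) capacity (suc m ^ (1 + ρ))) ⟨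
    σ * K + (2 + σ) * (3 + ρ) * capacity * suc m ^ (1 + ρ) + suc m + K
      ≤⟨ +-monoˡ-≤ K (+-monoˡ-≤ (suc m) (+-monoʳ-≤ (σ * K) (*-monoˡ-≤ (suc m ^ (1 + ρ)) large₁))) ⟩
    σ * K + K + suc m + K
      ≡⟨ e σ K (suc m) ⟩
    (2 + σ) * K + suc m ∎
    where
    open ≤-Reasoning
    K = suc m ^ (2 + ρ)
    e : ∀ σ k n → σ * k + k + n + k ≡ (2 + σ) * k + n
    e = solve-∀
  -- Two disjoint members of `remainder` would extend along `L` to a matching of size `3 + σ`, and a
  -- vertex covering `remainder` would complete `L` to a transversal of size `2 + σ`; so
  -- `Intersecting` applies.
  ... | inj₂ L≡1+σ = begin
    length F + (2 + σ) + m ^ (2 + ρ)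
      ≤⟨ +-monoˡ-≤ (m ^ (2 + ρ)) (+-monoˡ-≤ (2 + σ) length-F) ⟩
    length L * K + length remainder + (2 + σ) + m ^ (2 + ρ)
      ≡⟨ cong₂ (λ a b → a * K + length remainder + suc b + m ^ (2 + ρ)) L≡1+σ (sym L≡1+σ) ⟩
    (1 + σ) * K + length remainder + suc (length L) + m ^ (2 + ρ)
      ≡⟨ e₁ ((1 + σ) * K) (length remainder) (length L) (m ^ (2 + ρ)) ⟩
    (1 + σ) * K + 1 + (length remainder + length L + m ^ (2 + ρ))
      ≤⟨ +-monoʳ-≤ ((1 + σ) * K + 1) (Intersecting.bound m ρ (Unique.filter⁺ (_avoids? L) F!) meets misses L!
           (proj₂ ∘ ∈-remainder⁻) (≤-trans length-L≤1+σ large₂) large₃) ⟩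
    (1 + σ) * K + 1 + (K + m)
      ≡⟨ e₂ σ K m ⟩
    (2 + σ) * K + suc m ∎
    where
    open ≤-Reasoning
    K = suc m ^ (2 + ρ)
    e₁ : ∀ a b c d → a + b + suc c + d ≡ a + 1 + (b + c + d)
    e₁ = solve-∀
    e₂ : ∀ σ k m → (1 + σ) * k + 1 + (k + m) ≡ (2 + σ) * k + suc m
    e₂ = solve-∀
    meets : ∀ {A B} → A ∈ remainder → B ∈ remainder → Meet A B
    meets {A} {B} A∈ B∈ with meet-or-disjoint A B
    ... | inj₁ meet = meet
    ... | inj₂ disj = contradiction (length-remainder-matching {A ∷ B ∷ []} (A∈ ∷ B∈ ∷ [] , (disj ∷ []) ∷ [] ∷ []))
      (<⇒≱ (s≤s (s≤s (≤-reflexive (sym L≡1+σ)))))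
    misses : ∀ v → ∃ λ B → B ∈ remainder × ¬ B ∋ v
    misses v with uncovered (v ∷ L) (s≤s length-L≤1+σ)
    ... | B , B∈ , ¬B∋v ∷ B# = B , ∈-remainder⁺ B∈ B# , ¬B∋v

-- The extremal construction.

module LowerBound (σ ρ j : ℕ) where

  -- Chosen so that the `suc m` values of the first part split into `1 + σ` values `below`, the
  -- single value `c`, and `suc j` values `above`.
  m : ℕ
  m = 1 + σ + suc j

  private
    S : Set
    S = Seq (suc m) (3 + ρ)

  zeros : Seq (suc m) (2 + ρ)
  zeros = Vec.replicate (2 + ρ) zero

  below : Fin (1 + σ) → Fin (suc m)
  below i = inject₁ i ↑ˡ suc j

  toℕ-below : ∀ i → toℕ (below i) ≤ σ
  toℕ-below i = subst (_≤ σ) (sym (trans (Fin.toℕ-↑ˡ (inject₁ i) (suc j)) (Fin.toℕ-inject₁ i))) (Fin.toℕ≤pred[n] i)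

  c : Fin (suc m)
  c = fromℕ (1 + σ) ↑ˡ suc j

  toℕ-c : toℕ c ≡ 1 + σ
  toℕ-c = trans (Fin.toℕ-↑ˡ (fromℕ (1 + σ)) (suc j)) (Fin.toℕ-fromℕ (1 + σ))

  above : Fin (suc j) → Fin (suc m)
  above i = (2 + σ) ↑ʳ i

  toℕ-above : ∀ i → 2 + σ ≤ toℕ (above i)
  toℕ-above i = subst (2 + σ ≤_) (sym (Fin.toℕ-↑ʳ (2 + σ) i)) (m≤m+n (2 + σ) (toℕ i))

  -- The Hilton-Milner family with centre `(zero , c)` and fixed tail `zeros`, restricted to first
  -- coordinates at least `1 + σ`. `Extremal` adds `1 + σ` full stars to it.
  Core : S → Set
  Core (a ∷ A) = (toℕ a ≡ 1 + σ × ∃ λ ℓ → lookup A ℓ ≡ lookup zeros ℓ) ⊎ (2 + σ ≤ toℕ a × A ≡ zeros)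

  Extremal : S → Set
  Extremal A = toℕ (lookup A zero) ≤ σ ⊎ Core A

  extremal? : ∀ A → Dec (Extremal A)
  extremal? (a ∷ A) = (toℕ a ≤? σ) ⊎-dec
    (((toℕ a ≟ 1 + σ) ×-dec Fin.any? (λ ℓ → lookup A ℓ Fin.≟ lookup zeros ℓ))
      ⊎-dec ((2 + σ ≤? toℕ a) ×-dec Vec.≡-dec Fin._≟_ A zeros))

  family : Family (suc m) (3 + ρ)
  family = filter extremal? (sequences full)

  family-unique : Unique family
  family-unique = Unique.filter⁺ extremal? (sequences-unique (full {suc m} {3 + ρ})
    λ ℓ → subst Unique (sym (lookup-full ℓ)) (Unique.allFin⁺ (suc m)))

  ∈-family⁺ : ∀ {A} → Extremal A → A ∈ family
  ∈-family⁺ {A} = ∈-filter⁺ extremal? (∈-sequences⁺ A full (∈ᵇ-full A))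

  ∈-family⁻ : ∀ {A} → A ∈ family → Extremal A
  ∈-family⁻ A∈ = proj₂ (∈-filter⁻ extremal? {xs = sequences full} A∈)

  core-≥ : ∀ {A} → Core A → 1 + σ ≤ toℕ (lookup A zero)
  core-≥ {a ∷ A} (inj₁ (eq , _)) = ≤-reflexive (sym eq)
  core-≥ {a ∷ A} (inj₂ (le , _)) = ≤-trans (n≤1+n _) le

  core-meet : ∀ {A B} → Core A → Core B → ¬ Disjoint A B
  core-meet {a ∷ A} {b ∷ B} (inj₁ (p , _)) (inj₁ (q , _)) d = d zero (Fin.toℕ-injective (trans p (sym q)))
  core-meet {a ∷ A} {b ∷ B} (inj₁ (_ , ℓ , eq)) (inj₂ (_ , refl)) d = d (suc ℓ) eq
  core-meet {a ∷ A} {b ∷ B} (inj₂ (_ , refl)) (inj₁ (_ , ℓ , eq)) d = d (suc ℓ) (sym eq)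
  core-meet {a ∷ A} {b ∷ B} (inj₂ (_ , refl)) (inj₂ (_ , refl)) d = d (suc zero) refl

  -- The members with small first coordinate fall into 1 + σ stars and all others are pairwise
  -- intersecting, so a matching has at most one member per label.
  label : S → ℕ
  label A = toℕ (lookup A zero) ⊓ (1 + σ)

  label-low : ∀ {A : S} → toℕ (lookup A zero) ≤ σ → label A ≡ toℕ (lookup A zero)
  label-low A≤ = m≤n⇒m⊓n≡m (≤-trans A≤ (n≤1+n σ))

  label-core : ∀ {A} → Core A → label A ≡ 1 + σ
  label-core {A} core = m≥n⇒m⊓n≡n (core-≥ {A} core)

  low≢core : ∀ {A B} → toℕ (lookup A zero) ≤ σ → Core B → label A ≢ label B
  low≢core {A} {B} A≤ core eq = <⇒≱ (s≤s A≤)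
    (≤-reflexive (sym (trans (sym (label-low {A} A≤)) (trans eq (label-core {B} core)))))

  label-injective : ∀ {A B} → Extremal A → Extremal B → Disjoint A B → label A ≢ label B
  label-injective {A} {B} (inj₁ A≤) (inj₁ B≤) d eq =
    d zero (Fin.toℕ-injective (trans (sym (label-low {A} A≤)) (trans eq (label-low {B} B≤))))
  label-injective {A} {B} (inj₁ A≤) (inj₂ cB) d eq = low≢core {A} {B} A≤ cB eq
  label-injective {A} {B} (inj₂ cA) (inj₁ B≤) d eq = low≢core {B} {A} B≤ cA (sym eq)
  label-injective {A} {B} (inj₂ cA) (inj₂ cB) d _ = core-meet {A} {B} cA cB d

  labels-unique : ∀ {M} → All (_∈ family) M → AllPairs Disjoint M → Unique (map label M)
  labels-unique [] [] = []
  labels-unique {A ∷ M} (A∈ ∷ M⊆) (A# ∷ M#) = All.map⁺ (All.tabulate λ {B} B∈ →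
    label-injective {A} {B} (∈-family⁻ A∈) (∈-family⁻ (All.lookup M⊆ B∈)) (All.lookup A# B∈)) ∷ labels-unique M⊆ M#

  ν≤ : NuAtMost (2 + σ) family
  ν≤ M (M⊆ , M#) = subst₂ _≤_ (length-map label M) (length-upTo (2 + σ))
    (unique-⊆⇒length≤ (labels-unique M⊆ M#) labels<)
    where
    labels< : map label M ⊆ upTo (2 + σ)
    labels< l∈ with ∈-map⁻ label l∈
    ... | A , _ , refl = ∈-upTo⁺ (s≤s (m⊓n≤n (toℕ (lookup A zero)) (1 + σ)))

  lowVertices : List (Vertex (suc m) (3 + ρ))
  lowVertices = map (λ i → zero , below i) (allFin (1 + σ))

  lowVertices-unique : Unique lowVertices
  lowVertices-unique = Unique.map⁺
    (λ eq → Fin.inject₁-injective (Fin.↑ˡ-injective (suc j) _ _ (cong proj₂ eq))) (Unique.allFin⁺ (1 + σ))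

  high-∉lowVertices : ∀ {A ℓ} → 1 + σ ≤ toℕ (lookup A zero) → (ℓ , lookup A ℓ) ∉ lowVertices
  high-∉lowVertices A≥ v∈ with ∈-map⁻ _ v∈
  ... | i , _ , eq with cong proj₁ eq
  ...   | refl = <⇒≱ A≥ (subst (λ a → toℕ a ≤ σ) (sym (cong proj₂ eq)) (toℕ-below i))

  fresh-value : ∀ (T : List (Vertex (suc m) (3 + ρ))) → length T < suc m → ∃ λ b → ∀ ℓ → (ℓ , b) ∉ T
  fresh-value T T< with search (λ b → ¬? (b ∈? map proj₂ T)) (allFin (suc m))
    where open DecMembership Fin._≟_
  ... | inj₁ (b , _ , b∉) = b , λ ℓ v∈ → b∉ (∈-map⁺ proj₂ v∈)
  ... | inj₂ none = contradiction
    (subst₂ _≤_ (length-allFin (suc m)) (length-map proj₂ T)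
      (unique-⊆⇒length≤ (Unique.allFin⁺ (suc m)) λ {b} b∈ → decidable-stable (b ∈? map proj₂ T) (none b∈)))
    (<⇒≱ T<)
    where open DecMembership Fin._≟_

  another : (q : Fin (2 + ρ)) → ∃ λ t → t ≢ q
  another zero    = suc zero , λ ()
  another (suc q) = zero , λ ()

  core₁ : S
  core₁ = c ∷ zeros

  core₁-core : Core core₁
  core₁-core = inj₁ (toℕ-c , zero , refl)

  -- No vertex of `core₁` lies on the whole core, so a transversal needs two vertices for the core
  -- besides those of the `1 + σ` stars.
  core-missing : ∀ ℓ → ∃ λ A → Core A × lookup A ℓ ≢ lookup core₁ ℓ
  core-missing zero = above zero ∷ zeros , inj₂ (toℕ-above zero , refl) ,
    λ eq → <⇒≢ (toℕ-above zero) (sym (trans (cong toℕ eq) toℕ-c))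
  core-missing (suc q) with another q
  ... | t , t≢q = c ∷ (zeros [ q ]≔ suc zero) , inj₁ (toℕ-c , t , Vec.lookup∘update′ t≢q zeros (suc zero)) ,
    λ eq → Fin.0≢1+n (trans (sym (Vec.lookup-replicate q zero)) (trans (sym eq) (Vec.lookup∘update q zeros (suc zero))))

  τ> : TauAbove (2 + σ) family
  τ> T T-transversal with 2 + σ <? length T
  ... | yes s<T = s<T
  ... | no s≮T = contradiction large s≮T
    where
    T≤s : length T ≤ 2 + σ
    T≤s = ≮⇒≥ s≮T
    covered : ∀ {A} → Extremal A → ∃ λ ℓ → (ℓ , lookup A ℓ) ∈ T
    covered {A} ext = All.lookup T-transversal (∈-family⁺ {A} ext)
    low⊆T : lowVertices ⊆ T
    -- A low first coordinate followed by a value that `T` uses in no part: only the low vertex can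
    -- be the one in `T`.
    low⊆T v∈ with ∈-map⁻ _ v∈ | fresh-value T (≤-<-trans T≤s (s≤s (s≤s (m<m+n σ (s≤s z≤n)))))
    ... | i , _ , refl | b , b∉ with covered {below i ∷ Vec.replicate (2 + ρ) b} (inj₁ (toℕ-below i))
    ...   | zero , v∈T = v∈T
    ...   | suc ℓ , v∈T = contradiction (subst (λ a → (suc ℓ , a) ∈ T) (Vec.lookup-replicate ℓ b) v∈T) (b∉ (suc ℓ))
    large : 2 + σ < length T
    large with covered {core₁} (inj₂ core₁-core)
    ... | ℓ₁ , v₁∈ with core-missing ℓ₁
    ...   | A₂ , core₂ , A₂≢ with covered {A₂} (inj₂ core₂)
    ...     | ℓ₂ , v₂∈ = subst (_≤ length T) (cong (2 +_) (trans (length-map _ (allFin (1 + σ))) (length-allFin (1 + σ))))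
      (unique-⊆⇒length≤ ((v₁≢v₂ ∷ ∉⇒All (high-∉lowVertices {core₁} (core-≥ {core₁} core₁-core)))
        ∷ ∉⇒All (high-∉lowVertices {A₂} (core-≥ {A₂} core₂)) ∷ lowVertices-unique) sub)
      where
      ∉⇒All : ∀ {v} → v ∉ lowVertices → All (v ≢_) lowVertices
      ∉⇒All v∉ = All.tabulate λ { u∈ refl → v∉ u∈ }
      v₁≢v₂ : (ℓ₁ , lookup core₁ ℓ₁) ≢ (ℓ₂ , lookup A₂ ℓ₂)
      v₁≢v₂ eq with cong proj₁ eq
      ... | refl = A₂≢ (sym (cong proj₂ eq))
      sub : (ℓ₁ , lookup core₁ ℓ₁) ∷ (ℓ₂ , lookup A₂ ℓ₂) ∷ lowVertices ⊆ T
      sub (here refl) = v₁∈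
      sub (there (here refl)) = v₂∈
      sub (there (there v∈)) = low⊆T v∈

  admissible : Admissible (2 + σ) (suc m) (3 + ρ) family
  admissible = family-unique , ν≤ , τ>

  -- `2 + σ` full stars and the sequences of `high` are covered by the family together with `rest`,
  -- the `m ^ (2 + ρ)` sequences through `c` that agree with `zeros` nowhere.
  length-family : (2 + σ) * suc m ^ (2 + ρ) + suc j ≤ length family + m ^ (2 + ρ)
  length-family = begin
    (2 + σ) * suc m ^ (2 + ρ) + suc j             ≡⟨ cong₂ _+_ size-low size-high ⟨
    size low + size high                          ≡⟨ length-++ (sequences low) ⟨
    length (sequences low ++ sequences high)      ≤⟨ unique-⊆⇒length≤ (Unique.++⁺ low! high! apart) within ⟩
    length (family ++ sequences rest)             ≡⟨ length-++ family ⟩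
    length family + size rest                     ≡⟨ cong (length family +_) size-rest ⟩
    length family + m ^ (2 + ρ) ∎
    where
    open ≤-Reasoning
    lowValues highValues : List (Fin (suc m))
    lowValues  = map (_↑ˡ suc j) (allFin (2 + σ))
    highValues = map above (allFin (suc j))
    low high rest : Box (suc m) (3 + ρ)
    low  = lowValues ∷ full
    high = highValues ∷ Vec.map (_∷ []) zeros
    rest = (c ∷ []) ∷ Vec.map others zeros
    size-low : size low ≡ (2 + σ) * suc m ^ (2 + ρ)
    size-low = trans (size-∷ lowValues (full {suc m} {2 + ρ}))
      (cong₂ _*_ (trans (length-map (_↑ˡ suc j) (allFin (2 + σ))) (length-allFin (2 + σ))) (size-full {suc m} {2 + ρ}))
    size-high : size high ≡ suc j
    size-high = trans (size-∷ highValues (Vec.map (_∷ []) zeros)) (trans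
      (cong₂ _*_ (trans (length-map above (allFin (suc j))) (length-allFin (suc j)))
        (trans (size-const 1 (Vec.map (_∷ []) zeros) λ ℓ → cong length (Vec.lookup-map ℓ (_∷ []) zeros))
          (^-zeroˡ (2 + ρ))))
      (*-identityʳ (suc j)))
    size-rest : size rest ≡ m ^ (2 + ρ)
    size-rest = trans (size-∷ (c ∷ []) (Vec.map others zeros)) (trans (*-identityˡ _)
      (size-const m (Vec.map others zeros) λ ℓ →
        trans (cong length (Vec.lookup-map ℓ others zeros)) (length-others (lookup zeros ℓ))))
    low! : Unique (sequences low)
    low! = sequences-unique low λ where
      zero    → Unique.map⁺ (Fin.↑ˡ-injective (suc j) _ _) (Unique.allFin⁺ (2 + σ))
      (suc ℓ) → subst Unique (sym (lookup-full ℓ)) (Unique.allFin⁺ (suc m))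
    high! : Unique (sequences high)
    high! = sequences-unique high λ where
      zero    → Unique.map⁺ (Fin.↑ʳ-injective (2 + σ) _ _) (Unique.allFin⁺ (suc j))
      (suc ℓ) → subst Unique (sym (Vec.lookup-map ℓ (_∷ []) zeros)) ([] ∷ [])
    low-value : ∀ {a} → a ∈ lowValues → toℕ a ≤ 1 + σ
    low-value a∈ with ∈-map⁻ _ a∈
    ... | i , _ , refl = subst (_≤ 1 + σ) (sym (Fin.toℕ-↑ˡ i (suc j))) (Fin.toℕ≤pred[n] i)
    high-value : ∀ {a} → a ∈ highValues → 2 + σ ≤ toℕ a
    high-value a∈ with ∈-map⁻ above a∈
    ... | i , _ , refl = toℕ-above i
    apart : ∀ {A} → ¬ (A ∈ sequences low × A ∈ sequences high)
    apart {A} (A∈l , A∈h) = <⇒≱ (high-value (∈-sequences⁻ A high A∈h zero)) (low-value (∈-sequences⁻ A low A∈l zero))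
    within : sequences low ++ sequences high ⊆ family ++ sequences rest
    within {a ∷ A} A∈ with ∈-++⁻ (sequences low) A∈
    ... | inj₂ A∈h = ∈-++⁺ˡ (∈-family⁺ {a ∷ A} (inj₂ (inj₂ (high-value (∈-sequences⁻ (a ∷ A) high A∈h zero) ,
        trans (sym (Vec.tabulate∘lookup A)) (trans (Vec.tabulate-cong same) (Vec.tabulate∘lookup zeros))))))
      where
      same : ∀ ℓ → lookup A ℓ ≡ lookup zeros ℓ
      same ℓ with subst (lookup A ℓ ∈_) (Vec.lookup-map ℓ (_∷ []) zeros) (∈-sequences⁻ (a ∷ A) high A∈h (suc ℓ))
      ... | here eq = eq
    ... | inj₁ A∈l with extremal? (a ∷ A)
    ...   | yes ext = ∈-++⁺ˡ (∈-family⁺ {a ∷ A} ext)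
    ...   | no ¬ext = ∈-++⁺ʳ family (∈-sequences⁺ (a ∷ A) rest λ where
        zero    → here (Fin.toℕ-injective (trans a≡1+σ (sym toℕ-c)))
        (suc ℓ) → subst (lookup A ℓ ∈_) (sym (Vec.lookup-map ℓ others zeros))
          (∈-others⁺ λ eq → ¬ext (inj₂ (inj₁ (a≡1+σ , ℓ , eq)))))
      where
      a≡1+σ : toℕ a ≡ 1 + σ
      a≡1+σ = ≤-antisym (low-value (∈-sequences⁻ (a ∷ A) low A∈l zero)) (≰⇒> (¬ext ∘ inj₁))

-- Combining the bounds into the exact value.

m0-value : ∀ {s n a b} → s ≤ n → b ≤ a → (a ∸ b + n ∸ s) + s + b ≡ a + n
m0-value {s} {n} {a} {b} s≤n b≤a = begin
  (a ∸ b + n ∸ s) + s + b   ≡⟨ cong (_+ b) (m∸n+n≡m (≤-trans s≤n (m≤n+m n (a ∸ b)))) ⟩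
  a ∸ b + n + b             ≡⟨ swap (a ∸ b) n b ⟩
  a ∸ b + b + n             ≡⟨ cong (_+ n) (m∸n+n≡m b≤a) ⟩
  a + n                     ∎
  where
  open ≡-Reasoning
  swap : ∀ x y z → x + y + z ≡ x + z + y
  swap = solve-∀

theorem1p7 : ∀ (r s : ℕ) → 3 ≤ r → 2 ≤ s →
    ∃ λ (N : ℕ) → ∀ (n : ℕ) → N < n →
    IsM0 s n r ((s * n ^ (r ∸ 1) ∸ (n ∸ 1) ^ (r ∸ 1)) + n ∸ s)
theorem1p7 (suc (suc (suc ρ))) (suc (suc σ)) (s≤s (s≤s (s≤s z≤n))) (s≤s (s≤s z≤n)) = N₁ + N₂ + (2 + σ) , λ n N<n →
  -- `n` is rewritten as `s + suc j`, the shape on which `LowerBound` is built.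
  let (j , eq) = m≤n⇒∃[o]m+o≡n (≤-trans (s≤s (m≤n+m s (N₁ + N₂))) N<n) in
  subst (λ n → N₁ + N₂ + s < n → IsM0 s n R ((s * n ^ (2 + ρ) ∸ (n ∸ 1) ^ (2 + ρ)) + n ∸ s))
    (trans (+-suc s j) eq) (exact j) N<n
  where
  s R N₁ N₂ : ℕ
  R  = 3 + ρ
  s  = 2 + σ
  -- `N₁` is `s * R` times `capacity` and settles the case of at most `s - 2` big vertices; `N₂`
  -- serves the unsaturated star case; the summand `s` in the threshold gives `s < n`.
  N₁ = s * R * (suc s + s * R)
  N₂ = R * R * R + (2 + ρ) * (2 + ρ)

  exact : ∀ j → N₁ + N₂ + s < s + suc j → IsM0 s (s + suc j) R
    ((s * (s + suc j) ^ (2 + ρ) ∸ (s + suc j ∸ 1) ^ (2 + ρ)) + (s + suc j) ∸ s)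
  exact j N<n = (family , admissible , ≤-antisym (upper family admissible) lower) , upper
    where
    open LowerBound σ ρ j
    K M value : ℕ
    K = s * suc m ^ (2 + ρ)
    M = m ^ (2 + ρ)
    value = K ∸ M + suc m ∸ s

    s≤n : s ≤ suc m
    s≤n = m≤m+n s (suc j)

    value-eq : value + s + M ≡ K + suc m
    -- Both truncated subtractions in `value` are exact here, because `s ≤ suc m` and `M ≤ K`.
    value-eq = m0-value s≤n (≤-trans (^-monoˡ-≤ (2 + ρ) (n≤1+n m)) (m≤m+n _ _))

    upper : ∀ F → Admissible s (suc m) R F → length F ≤ value
    upper F F-adm = +-cancelʳ-≤ s _ _ (+-cancelʳ-≤ M _ _ (≤-trans
      (UpperBound.upper-bound m ρ σ F-adm
        (≤-trans (≤-trans (m≤m+n N₁ N₂) (m≤m+n (N₁ + N₂) s)) (<⇒≤ N<n))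
        (s≤s⁻¹ s≤n)
        (≤-trans (≤-trans (m≤n+m N₂ N₁) (m≤m+n (N₁ + N₂) s)) (<⇒≤ N<n)))
      (≤-reflexive (sym value-eq))))

    lower : value ≤ length family
    lower = +-cancelʳ-≤ s _ _ (+-cancelʳ-≤ M _ _ (begin
      value + s + M                ≡⟨ value-eq ⟩
      K + suc m                    ≡⟨ e K s (suc j) ⟩
      K + suc j + s                ≤⟨ +-monoˡ-≤ s length-family ⟩
      length family + M + s        ≡⟨ e′ (length family) M s ⟩
      length family + s + M        ∎))
      where
      open ≤-Reasoning
      e : ∀ a b c → a + (b + c) ≡ a + c + b
      e = solve-∀
      e′ : ∀ a b c → a + b + c ≡ a + c + b
      e′ = solve-∀
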